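{- Let $k\ge 6$. If $k$ and $g$ satisfy one of the following conditions, then there exists no $(k,g)$-graph of cyclic excess $4$: 1) $k\equiv 1$ or $2 \pmod 3$ and $g=8$; 2) $k\equiv 1\pmod 3$ and $g=12$; 3) $k\equiv 1\pmod 3$ and $g=16$.
   Context: Graphs are finite and simple. A $(k,g)$-graph is a $k$-regular graph of girth $g$. For even $g=2d$ the Moore bound is $M(k,g)=2\bigl(1+(k-1)+\dots+(k-1)^{d-1}\bigr)$, and the excess of a $(k,g)$-graph of order $n$ is $n-M(k,g)$. For $k\ge 6$ and $g=2d\ge 6$, a $(k,g)$-graph $G$ of excess $4$ is bipartite of diameter $d+1$ (known theorem of Biggs and Ito). The excess graph $G(E)$ of such a graph $G$ is the graph on the vertex set of $G$ in which two vertices are adjacent if and only if their distance in $G$ is $d+1$. A $(k,g)$-graph $G$ of excess $4$ and order $n$ has cyclic excess $4$ if $G(E)$ is a single cycle of length $n$. -}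

module Defs where

open import Data.Fin using (Fin; toℕ)
open import Data.Fin.Properties using (any?) renaming (_≟_ to _≟ᶠ_)
open import Data.List using (length; filter; allFin; sum; map; upTo)
open import Data.Nat using (ℕ; zero; suc; _*_; _∸_; _^_; _≤_; _<_; _≟_; z≤n; s≤s)
open import Data.Nat.Properties using (allUpTo?; 1+n≢n; <⇒≢; ≤-trans; n≤1+n)
open import Data.Product using (Σ; _×_; _,_)
open import Data.Sum using (_⊎_; inj₁; inj₂; swap)
open import Function.Base using (_∘_)
open import Function.Bundles using (_⇔_; _⤖_; Bijection)
open import Function.Definitions using (Injective)
open import Relation.Binary.PropositionalEquality using (_≡_; refl; sym; trans; cong)
open import Relation.Nullary using (¬_; Dec; ¬?)
open import Relation.Nullary.Decidable using (map′; _×-dec_; _⊎-dec_)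

-- Finite simple graphs of order n.  Adjacency is required to be decidable,
-- as it is classically for any finite graph.
record Graph (n : ℕ) : Set₁ where
  field
    Adj    : Fin n → Fin n → Set
    adj?   : ∀ u v → Dec (Adj u v)
    symm   : ∀ {u v} → Adj u v → Adj v u
    irrefl : ∀ {v} → ¬ Adj v v

open Graph public

degree : ∀ {n} → Graph n → Fin n → ℕ
degree {n} G v = length (filter (adj? G v) (allFin n))

Regular : ∀ {n} → ℕ → Graph n → Set
Regular k G = ∀ v → degree G v ≡ k

infix 4 _≅_

_≅_ : ∀ {m n} → Graph m → Graph n → Set
_≅_ {m} {n} G H = Σ (Fin m ⤖ Fin n) λ f →
  ∀ u v → Adj G u v ⇔ Adj H (Bijection.to f u) (Bijection.to f v)

-- j is the successor of i in the cyclic order 0, 1, …, m − 1, 0.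
CyclicSucc : ∀ {m} → Fin m → Fin m → Set
CyclicSucc {m} i j = suc (toℕ i) ≡ toℕ j ⊎ (suc (toℕ i) ≡ m × toℕ j ≡ 0)

cyclicSucc? : ∀ {m} (i j : Fin m) → Dec (CyclicSucc i j)
cyclicSucc? {m} i j =
  (suc (toℕ i) ≟ toℕ j) ⊎-dec ((suc (toℕ i) ≟ m) ×-dec (toℕ j ≟ 0))

cyclicSucc-irrefl : ∀ {m} → 2 ≤ m → {i : Fin m} → ¬ CyclicSucc i i
cyclicSucc-irrefl _   (inj₁ p)       = 1+n≢n p
cyclicSucc-irrefl 2≤m (inj₂ (p , q)) = <⇒≢ 2≤m (trans (cong suc (sym q)) p)

cycleGraph : (m : ℕ) → 3 ≤ m → Graph m
cycleGraph m 3≤m = record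
  { Adj    = λ i j → CyclicSucc i j ⊎ CyclicSucc j i
  ; adj?   = λ i j → cyclicSucc? i j ⊎-dec cyclicSucc? j i
  ; symm   = swap
  ; irrefl = λ { (inj₁ p) → cyclicSucc-irrefl 2≤m p
               ; (inj₂ p) → cyclicSucc-irrefl 2≤m p }
  }
  where
  2≤m : 2 ≤ m
  2≤m = ≤-trans (n≤1+n 2) 3≤m

-- A cycle of length m in G, as a (not necessarily induced) copy of the
-- cycle graph on m vertices.
Cycle : ∀ {n} → Graph n → ℕ → Set
Cycle {n} G m = Σ (3 ≤ m) λ 3≤m → Σ (Fin m → Fin n) λ c →
  Injective _≡_ _≡_ c × (∀ i j → Adj (cycleGraph m 3≤m) i j → Adj G (c i) (c j))

HasGirth : ∀ {n} → Graph n → ℕ → Set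
HasGirth G g = Cycle G g × (∀ m → Cycle G m → g ≤ m)

IsKGGraph : ∀ {n} → ℕ → ℕ → Graph n → Set
IsKGGraph k g G = Regular k G × HasGirth G g

data Walk {n} (G : Graph n) : ℕ → Fin n → Fin n → Set where
  []  : ∀ {v} → Walk G 0 v v
  _∷_ : ∀ {ℓ u v w} → Adj G u v → Walk G ℓ v w → Walk G (suc ℓ) u w

-- The distance between u and v is finite and equal to r.
Distance : ∀ {n} → Graph n → Fin n → Fin n → ℕ → Set
Distance G u v r = Walk G r u v × (∀ {ℓ} → ℓ < r → ¬ Walk G ℓ u v)

walk? : ∀ {n} (G : Graph n) ℓ u v → Dec (Walk G ℓ u v)
walk? G zero u v = map′ (λ { refl → [] }) (λ { [] → refl }) (u ≟ᶠ v)
walk? G (suc ℓ) u v =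
  map′ (λ { (_ , a , w) → a ∷ w }) (λ { (a ∷ w) → _ , a , w })
       (any? (λ x → adj? G u x ×-dec walk? G ℓ x v))

distance? : ∀ {n} (G : Graph n) u v r → Dec (Distance G u v r)
distance? G u v r = walk? G r u v ×-dec allUpTo? (λ ℓ → ¬? (walk? G ℓ u v)) r

snoc : ∀ {n} {G : Graph n} {ℓ u v w} → Walk G ℓ u v → Adj G v w → Walk G (suc ℓ) u w
snoc []      b = b ∷ []
snoc (a ∷ p) b = a ∷ snoc p b

reverse : ∀ {n} {G : Graph n} {ℓ u v} → Walk G ℓ u v → Walk G ℓ v u
reverse         []      = []
reverse {G = G} (a ∷ p) = snoc (reverse p) (symm G a)

-- The Moore bound for degree k and girth 2d.
mooreBound : ℕ → ℕ → ℕ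
mooreBound k d = 2 * sum (map (λ i → (k ∸ 1) ^ i) (upTo d))

-- The excess graph of a graph of girth 2d.
excessGraph : ∀ {n} → Graph n → ℕ → Graph n
excessGraph G d = record
  { Adj    = λ u v → Distance G u v (suc d)
  ; adj?   = λ u v → distance? G u v (suc d)
  ; symm   = λ { (w , min) → reverse w , λ ℓ<r → min ℓ<r ∘ reverse }
  ; irrefl = λ { (_ , min) → min (s≤s z≤n) [] }
  }

IsSingleCycle : ∀ {n} → Graph n → Set
IsSingleCycle {n} H = Σ (3 ≤ n) λ 3≤n → H ≅ cycleGraph n 3≤n

-- Truncated subtraction is harmless in `excess`: it equals 4 only if
-- n = mooreBound k d + 4.
record HasCyclicExcess4 (k g : ℕ) {n : ℕ} (G : Graph n) : Set where
  field
    isKGGraph     : IsKGGraph k g G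
    d             : ℕ
    evenGirth     : g ≡ 2 * d
    excess        : n ∸ mooreBound k d ≡ 4
    isSingleCycle : IsSingleCycle (excessGraph G d)

{-# OPTIONS --safe #-}

-- Let g = 2d, e = d − 1, q = k − 1, and let E be the adjacency operator of the
-- excess graph.  Since walks of length i ≤ e are controlled by the girth, the
-- 0/1 matrix of "joined by a walk of length e" is a polynomial P_e(A).  Counting
-- shows that the rows of C = P_e(A) + E at adjacent vertices are complementary,
-- so C commutes with A and E and kills every f with E f = − f; on such f hence
-- P_e(A) f = f.  When 3 ∣ n these f are the sequences along the cycle with
-- f(i) + f(i+1) + f(i+2) = 0, a lattice of rank 2 on which A acts by an integer
-- matrix S with P_e(S) = 1.  Reducing modulo the characteristic polynomial of S,
-- P_e(S) = α S + β: if α ≠ 0 then S has an integer eigenvalue x with P_e(x) = 1,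
-- and x ∣ 1 is impossible for size reasons; if α = 0 and β = 1 the
-- contradiction is a direct computation (d = 4) or one modulo 3 (d = 6, 8).

module Submission where

open import Defs
open import Data.Bool using (if_then_else_)
open import Data.Empty using (⊥-elim)
open import Data.Fin using (Fin; zero; suc; toℕ; fromℕ; fromℕ<; inject₁)
open import Data.Fin.Properties as Fin using (any?; all?; toℕ-injective; toℕ-fromℕ; toℕ-fromℕ<; toℕ-inject₁; toℕ<n) renaming (_≟_ to _≟ᶠ_)
open import Data.Integer as ℤ using (ℤ; +_; -_; -[1+_]; _+_; _*_; _-_; 0ℤ; 1ℤ)
open import Data.Integer.DivMod using (_%ℕ_; _/ℕ_; a≡a%ℕn+[a/ℕn]*n; n%ℕd<d)
open import Data.Integer.Divisibility.Signed using (_∣_; divides; _∣?_; ∣m∣n⇒∣m+n; ∣m⇒∣-m; ∣m⇒∣m*n; ∣n⇒∣m*n)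
import Data.Integer.Properties as ℤ
open import Data.Integer.Tactic.RingSolver using (solve-∀)
open import Data.List using (filter; length; tabulate; applyUpTo)
open import Data.List.Properties using (map-applyUpTo)
open import Data.Nat as ℕ using (ℕ; zero; suc; _≤_; _<_; _%_; z≤n; s≤s)
open import Data.Nat.DivMod using (_/_; m≡m%n+[m/n]*n)
open import Data.Nat.Induction using (<-rec)
import Data.Nat.ListAction as ℕ using (sum)
import Data.Nat.Properties as ℕ
open import Data.Nat.Tactic.RingSolver using () renaming (solve-∀ to ℕsolve-∀)
open import Data.Product using (Σ; ∃; ∃-syntax; _×_; _,_; proj₁; proj₂)
open import Data.Sum using (_⊎_; inj₁; inj₂; [_,_]′; map)
open import Function.Base using (_∘_)
open import Function.Bundles using (Bijection; Inverse; Equivalence)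
open import Function.Definitions using (Injective)
open import Function.Properties.Bijection using (⤖⇒↔)
open import Relation.Binary.PropositionalEquality using (_≡_; _≢_; refl; sym; trans; cong; cong₂; subst; module ≡-Reasoning)
open import Relation.Nullary using (¬_; ¬?; Dec; yes; no; does)
open import Relation.Nullary.Decidable using (_×-dec_; _⊎-dec_; from-yes)

open import Algebra.Properties.AbelianGroup ℤ.+-0-abelianGroup using (∙-cancelʳ; xyx⁻¹≈y; x∙y⁻¹≈ε⇒x≈y)
open import Algebra.Properties.Semiring.Sum ℤ.+-*-semiring using (sum; sum-cong-≗; ∑-distrib-+; ∑-comm; *-distribˡ-sum; *-distribʳ-sum)

open ≡-Reasoning

private
  variable
    n ℓ m : ℕ
    G : Graph n
    u v w x y : Fin n

-- Closed walks shorter than the girth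

infixr 5 _++_

_++_ : Walk G ℓ u v → Walk G m v w → Walk G (ℓ ℕ.+ m) u w
[]      ++ q = q
(a ∷ p) ++ q = a ∷ (p ++ q)

unsnoc : Walk G (suc ℓ) u v → ∃ λ w → Walk G ℓ u w × Adj G w v
unsnoc (a ∷ [])      = _ , [] , a
unsnoc (a ∷ (b ∷ p)) with _ , q , c ← unsnoc (b ∷ p) = _ , a ∷ q , c

vertex : {G : Graph n} → Walk G ℓ u v → Fin (suc ℓ) → Fin n
vertex {u = u} p zero    = u
vertex (a ∷ p)   (suc i) = vertex p i

vertex-last : (p : Walk G ℓ u v) → vertex p (fromℕ ℓ) ≡ v
vertex-last []      = refl
vertex-last (a ∷ p) = vertex-last p

vertex-adj : (p : Walk G ℓ u v) (i j : Fin (suc ℓ)) → suc (toℕ i) ≡ toℕ j →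
  Adj G (vertex p i) (vertex p j)
vertex-adj (a ∷ p) zero    (suc zero) _  = a
vertex-adj (a ∷ p) (suc i) (suc j)    eq = vertex-adj p i j (ℕ.suc-injective eq)

SimplePath : Graph n → ℕ → Fin n → Fin n → Set
SimplePath G ℓ u v = ∃ λ m → m ≤ ℓ × Σ (Walk G m u v) λ p → Injective _≡_ _≡_ (vertex p)

simple-suffix : (p : Walk G ℓ u v) → Injective _≡_ _≡_ (vertex p) →
  (i : Fin (suc ℓ)) → SimplePath G ℓ (vertex p i) v
simple-suffix p       inj zero    = _ , ℕ.≤-refl , p , inj
simple-suffix (a ∷ p) inj (suc i)
  with m , m≤ℓ , q , q-inj ← simple-suffix p (Fin.suc-injective ∘ inj) i
  = m , ℕ.m≤n⇒m≤1+n m≤ℓ , q , q-inj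

-- If the first vertex recurs on the path obtained from the tail, the suffix starting at that
-- recurrence replaces everything before it; otherwise the first edge is kept.
loopErase : Walk G ℓ u v → SimplePath G ℓ u v
loopErase [] = 0 , z≤n , [] , λ { {zero} {zero} _ → refl }
loopErase {u = u} (a ∷ p) with m , m≤ℓ , q , q-inj ← loopErase p
  with any? (λ i → vertex q i ≟ᶠ u)
... | yes (i , refl) with m′ , m′≤m , r ← simple-suffix q q-inj i
  = m′ , ℕ.m≤n⇒m≤1+n (ℕ.≤-trans m′≤m m≤ℓ) , r
... | no fresh = suc m , s≤s m≤ℓ , a ∷ q , inj
  where
  inj : Injective _≡_ _≡_ (vertex (a ∷ q))
  inj {zero}  {zero}  _  = refl
  inj {zero}  {suc j} eq = ⊥-elim (fresh (j , sym eq))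
  inj {suc i} {zero}  eq = ⊥-elim (fresh (i , eq))
  inj {suc i} {suc j} eq = cong suc (q-inj eq)

-- The vertex `x` stays as an isolated vertex, so that the vertex type is unchanged.
delete : Graph n → Fin n → Graph n
delete G x = record
  { Adj    = λ u v → Adj G u v × u ≢ x × v ≢ x
  ; adj?   = λ u v → adj? G u v ×-dec ¬? (u ≟ᶠ x) ×-dec ¬? (v ≟ᶠ x)
  ; symm   = λ (a , u≢x , v≢x) → symm G a , v≢x , u≢x
  ; irrefl = irrefl G ∘ proj₁
  }

undelete : ∀ (G : Graph n) x → Walk (delete G x) ℓ u v → Walk G ℓ u v
undelete G x []      = []
undelete G x (a ∷ p) = proj₁ a ∷ undelete G x p

vertex-undelete : ∀ (G : Graph n) x (p : Walk (delete G x) ℓ u v) (i : Fin (suc ℓ)) →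
  vertex (undelete G x p) i ≡ vertex p i
vertex-undelete G x []      zero    = refl
vertex-undelete G x (a ∷ p) zero    = refl
vertex-undelete G x (a ∷ p) (suc i) = vertex-undelete G x p i

vertex-avoids : ∀ (G : Graph n) x → u ≢ x → (p : Walk (delete G x) ℓ u v) (i : Fin (suc ℓ)) →
  vertex p i ≢ x
vertex-avoids G x u≢x p                   zero    = u≢x
vertex-avoids G x u≢x ((_ , _ , ≢x) ∷ p) (suc i) = vertex-avoids G x ≢x p i

-- Loop erasure inside `delete G x` gives a simple path that avoids `x`, and joining its ends
-- through `x` closes it. Since `u ≢ v` the path has an edge, so the cycle has at least three
-- vertices.
detour⇒cycle : ∀ (G : Graph n) → Adj G x u → Adj G x v → u ≢ v → Walk (delete G x) ℓ u v →
  ∃ λ m → m ≤ 2 ℕ.+ ℓ × Cycle G m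
detour⇒cycle {x = x} {u = u} {v = v} G a b u≢v w with loopErase w
... | zero  , _   , [] , _  = ⊥-elim (u≢v refl)
... | suc m , m≤ℓ , p , p-inj = 3 ℕ.+ m , s≤s (s≤s m≤ℓ) , s≤s (s≤s (s≤s z≤n)) , c , c-inj , c-adj
  where
  u≢x : u ≢ x
  u≢x refl = irrefl G a

  c : Fin (3 ℕ.+ m) → _
  c zero    = x
  c (suc i) = vertex (undelete G x p) i

  avoids : ∀ i → vertex (undelete G x p) i ≢ x
  avoids i eq = vertex-avoids G x u≢x p i (trans (sym (vertex-undelete G x p i)) eq)

  c-inj : Injective _≡_ _≡_ c
  c-inj {zero}  {zero}  _  = refl
  c-inj {zero}  {suc j} eq = ⊥-elim (avoids j (sym eq))
  c-inj {suc i} {zero}  eq = ⊥-elim (avoids i eq)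
  c-inj {suc i} {suc j} eq =
    cong suc (p-inj (trans (sym (vertex-undelete G x p i)) (trans eq (vertex-undelete G x p j))))

  succ-adj : ∀ i j → CyclicSucc i j → Adj G (c i) (c j)
  succ-adj zero    (suc zero) (inj₁ _)  = a
  succ-adj (suc i) (suc j)    (inj₁ eq) = vertex-adj (undelete G x p) i j (ℕ.suc-injective eq)
  succ-adj (suc i) zero       (inj₂ (eq , _)) = subst (λ z → Adj G z x) (sym end) (symm G b)
    where
    end : vertex (undelete G x p) i ≡ v
    end = trans (cong (vertex (undelete G x p)) (toℕ-injective
            (trans (ℕ.suc-injective (ℕ.suc-injective eq)) (sym (toℕ-fromℕ (suc m))))))
            (vertex-last (undelete G x p))

  c-adj : ∀ i j → CyclicSucc i j ⊎ CyclicSucc j i → Adj G (c i) (c j)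
  c-adj i j (inj₁ s) = succ-adj i j s
  c-adj i j (inj₂ s) = symm G (succ-adj j i s)

-- In the second case the walk is cut at its first visit to `x`; the first piece is nonempty because
-- `u ≢ x`.
avoid-or-visit : ∀ x → u ≢ x → Walk G ℓ u v →
  Walk (delete G x) ℓ u v ⊎ ∃ λ i → ∃ λ j → suc i ℕ.+ j ≡ ℓ × Walk G (suc i) u x × Walk G j x v
avoid-or-visit x u≢x [] = inj₁ []
avoid-or-visit x u≢x (_∷_ {v = w} a p) with w ≟ᶠ x
... | yes refl = inj₂ (0 , _ , refl , a ∷ [] , p)
... | no w≢x with avoid-or-visit x w≢x p
...   | inj₁ q                      = inj₁ ((a , u≢x , w≢x) ∷ q)
...   | inj₂ (i , j , refl , q , r) = inj₂ (suc i , j , refl , a ∷ q , r)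

data Even : ℕ → Set where
  zero : Even 0
  2+_  : Even ℓ → Even (2 ℕ.+ ℓ)

even-+ : Even ℓ → Even m → Even (ℓ ℕ.+ m)
even-+ zero    f = f
even-+ (2+ e) f = 2+ even-+ e f

¬even-1+2* : ∀ ℓ → ¬ Even (suc (ℓ ℕ.+ ℓ))
¬even-1+2* (suc ℓ) (2+ e) with e′ ← subst Even (ℕ.+-suc ℓ ℓ) e = ¬even-1+2* ℓ e′

-- Going back and forth along an edge at the start lengthens a walk by any even number.
pad : Adj G u w → Even ℓ → Walk G m u v → Walk G (ℓ ℕ.+ m) u v
pad a zero   p = p
pad {G = G} a (2+ e) p = a ∷ (symm G a ∷ pad a e p)

module _ {n : ℕ} {G : Graph n} {g : ℕ} (girth≥ : ∀ m → Cycle G m → g ≤ m) where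

  no-detour : Adj G x u → Adj G x v → u ≢ v → Walk (delete G x) ℓ u v → g ≤ 2 ℕ.+ ℓ
  no-detour a b u≢v p with m , m≤ , c ← detour⇒cycle G a b u≢v p = ℕ.≤-trans (girth≥ m c) m≤

  -- Strong induction, removing the first and last edge at `x`. If the middle part revisits `x`, the
  -- walk splits into two shorter closed walks. If not, either its two ends agree and it is a closed
  -- walk shorter by two, or they differ and it is a detour around `x`, giving a cycle below the
  -- girth.
  closed-even : ∀ ℓ {x} → Walk G ℓ x x → ℓ < g → Even ℓ
  closed-even = <-rec _ step
    where
    step : ∀ ℓ → (∀ {m} → m < ℓ → ∀ {x} → Walk G m x x → m < g → Even m) →
      ∀ {x} → Walk G ℓ x x → ℓ < g → Even ℓ
    step 0 rec p ℓ<g = zero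
    step 1 rec (a ∷ []) ℓ<g = ⊥-elim (irrefl G a)
    step (suc (suc ℓ)) rec {x} (_∷_ {v = u} a p) ℓ<g
      with y , q , b ← unsnoc p
      with avoid-or-visit x (λ { refl → irrefl G a }) q
    ... | inj₂ (i , j , refl , r , s) =
      subst Even (ℕ.+-suc (2 ℕ.+ i) j)
        (even-+ (rec i< (a ∷ r) (ℕ.<-trans i< ℓ<g)) (rec j< (snoc s b) (ℕ.<-trans j< ℓ<g)))
      where
      i< : 2 ℕ.+ i < 3 ℕ.+ (i ℕ.+ j)
      i< = s≤s (s≤s (s≤s (ℕ.m≤m+n i j)))
      j< : suc j < 3 ℕ.+ (i ℕ.+ j)
      j< = s≤s (s≤s (ℕ.m≤n⇒m≤1+n (ℕ.m≤n+m j i)))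
    ... | inj₁ r with u ≟ᶠ y
    ...   | yes refl = 2+ rec (ℕ.m≤n⇒m≤1+n ℕ.≤-refl) q (ℕ.<-trans (ℕ.m≤n⇒m≤1+n ℕ.≤-refl) ℓ<g)
    ...   | no u≢y   = ⊥-elim (ℕ.<⇒≱ ℓ<g (no-detour a (symm G b) u≢y r))

  -- If one of the two walks returns to `u`, the closed walk up to that return has even length
  -- `2 + i`, so the remainder can be padded by `i` to length `ℓ`. If both avoid `u`, together they
  -- form a detour and a cycle of length at most `2 ℓ + 4` arises.
  forget-first : Adj G u x → Adj G u y → x ≢ y → Walk G (suc ℓ) x v → Walk G (suc ℓ) y v →
    4 ℕ.+ (ℓ ℕ.+ ℓ) < g → Walk G ℓ u v
  forget-first {u} {x} {y} {ℓ} {v} a b x≢y p q lt = go (visit a p) (visit b q)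
    where
    visit : ∀ {z} → Adj G u z → Walk G (suc ℓ) z v → Walk (delete G u) (suc ℓ) z v ⊎ Walk G ℓ u v
    visit c r with avoid-or-visit u (λ { refl → irrefl G c }) r
    ... | inj₁ r′ = inj₁ r′
    ... | inj₂ (i , j , refl , s , t)
      with 2+ even ← closed-even (2 ℕ.+ i) (c ∷ s)
             (ℕ.≤-<-trans (s≤s (s≤s (ℕ.m≤n⇒m≤1+n (ℕ.m≤n⇒m≤1+n (ℕ.≤-trans (ℕ.m≤m+n i j) (ℕ.m≤m+n (i ℕ.+ j) (i ℕ.+ j))))))) lt)
      = inj₂ (pad c even t)
    go : Walk (delete G u) (suc ℓ) x v ⊎ Walk G ℓ u v → Walk (delete G u) (suc ℓ) y v ⊎ Walk G ℓ u v → Walk G ℓ u v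
    go (inj₂ r) _        = r
    go (inj₁ _) (inj₂ r) = r
    go (inj₁ p′) (inj₁ q′) = ⊥-elim (ℕ.<⇒≱ lt
      (subst (g ≤_) (cong (3 ℕ.+_) (ℕ.+-suc ℓ ℓ)) (no-detour a b x≢y (p′ ++ reverse q′))))

  -- The edge and the two walks form a closed walk of odd length `2 ℓ + 1`.
  ¬both-ends : Adj G u w → Walk G ℓ u v → Walk G ℓ w v → ¬ suc (ℓ ℕ.+ ℓ) < g
  ¬both-ends {ℓ = ℓ} a p q lt = ¬even-1+2* ℓ (closed-even _ (a ∷ (q ++ reverse p)) lt)

-- Integer-valued functions and matrices

𝟙 : ∀ {P : Set} → Dec P → ℤ
𝟙 p? = if does p? then 1ℤ else 0ℤ

𝟙-yes : ∀ {P : Set} (p? : Dec P) → P → 𝟙 p? ≡ 1ℤ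
𝟙-yes (yes _) _ = refl
𝟙-yes (no ¬p) p = ⊥-elim (¬p p)

𝟙-no : ∀ {P : Set} (p? : Dec P) → ¬ P → 𝟙 p? ≡ 0ℤ
𝟙-no (yes p) ¬p = ⊥-elim (¬p p)
𝟙-no (no _)  _  = refl

𝟙-cong : ∀ {P Q : Set} (p? : Dec P) (q? : Dec Q) → (P → Q) → (Q → P) → 𝟙 p? ≡ 𝟙 q?
𝟙-cong (yes p) q? f g = sym (𝟙-yes q? (f p))
𝟙-cong (no ¬p) q? f g = sym (𝟙-no q? (¬p ∘ g))

sum-nonneg : (f : Fin n → ℤ) → (∀ i → 0ℤ ℤ.≤ f i) → 0ℤ ℤ.≤ sum f
sum-nonneg {zero}  f f≥0 = ℤ.≤-refl
sum-nonneg {suc n} f f≥0 = ℤ.+-mono-≤ (f≥0 zero) (sum-nonneg (f ∘ suc) (f≥0 ∘ suc))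

sum-mono-≤ : (f g : Fin n → ℤ) → (∀ i → f i ℤ.≤ g i) → sum f ℤ.≤ sum g
sum-mono-≤ {zero}  f g f≤g = ℤ.≤-refl
sum-mono-≤ {suc n} f g f≤g = ℤ.+-mono-≤ (f≤g zero) (sum-mono-≤ (f ∘ suc) (g ∘ suc) (f≤g ∘ suc))

nonneg-+≡0 : ∀ {x y} → 0ℤ ℤ.≤ x → 0ℤ ℤ.≤ y → x + y ≡ 0ℤ → x ≡ 0ℤ × y ≡ 0ℤ
nonneg-+≡0 {+ zero} {+ zero} _ _ _ = refl , refl

sum≡0⇒≡0 : (f : Fin n → ℤ) → (∀ i → 0ℤ ℤ.≤ f i) → sum f ≡ 0ℤ → ∀ i → f i ≡ 0ℤ
sum≡0⇒≡0 {suc n} f f≥0 eq zero =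
  proj₁ (nonneg-+≡0 (f≥0 zero) (sum-nonneg (f ∘ suc) (f≥0 ∘ suc)) eq)
sum≡0⇒≡0 {suc n} f f≥0 eq (suc i) = sum≡0⇒≡0 (f ∘ suc) (f≥0 ∘ suc)
  (proj₂ (nonneg-+≡0 (f≥0 zero) (sum-nonneg (f ∘ suc) (f≥0 ∘ suc)) eq)) i

sum-zero : (f : Fin n → ℤ) → (∀ i → f i ≡ 0ℤ) → sum f ≡ 0ℤ
sum-zero {zero}  f f≡0 = refl
sum-zero {suc n} f f≡0 = cong₂ _+_ (f≡0 zero) (sum-zero (f ∘ suc) (f≡0 ∘ suc))

sum-linear : ∀ a b (f g : Fin n → ℤ) → sum (λ i → a * f i + b * g i) ≡ a * sum f + b * sum g
sum-linear a b f g = trans (∑-distrib-+ (λ i → a * f i) (λ i → b * g i))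
  (sym (cong₂ _+_ (*-distribˡ-sum a f) (*-distribˡ-sum b g)))

sum-δ : ∀ (u : Fin n) (f : Fin n → ℤ) → sum (λ v → 𝟙 (u ≟ᶠ v) * f v) ≡ f u
sum-δ {suc n} zero f = begin
  1ℤ * f zero + sum (λ v → 0ℤ * f (suc v))
    ≡⟨ cong₂ _+_ (ℤ.*-identityˡ (f zero)) (sum-zero (λ v → 0ℤ * f (suc v)) (λ v → ℤ.*-zeroˡ (f (suc v)))) ⟩
  f zero + 0ℤ ≡⟨ ℤ.+-identityʳ (f zero) ⟩
  f zero      ∎
sum-δ {suc n} (suc u) f = begin
  0ℤ * f zero + sum (λ v → 𝟙 (u ≟ᶠ v) * f (suc v)) ≡⟨ cong₂ _+_ (ℤ.*-zeroˡ (f zero)) (sum-δ u (f ∘ suc)) ⟩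
  0ℤ + f (suc u)                                      ≡⟨ ℤ.+-identityˡ _ ⟩
  f (suc u)                                           ∎

length-filter : ∀ {A : Set} {P : A → Set} (P? : ∀ x → Dec (P x)) (f : Fin n → A) →
  + length (filter P? (tabulate f)) ≡ sum (λ i → 𝟙 (P? (f i)))
length-filter {zero}  P? f = refl
length-filter {suc n} P? f with P? (f zero)
... | yes _ = cong (_+_ 1ℤ) (length-filter P? (f ∘ suc))
... | no _  = trans (length-filter P? (f ∘ suc)) (sym (ℤ.+-identityˡ _))

infixr 7 _▹_

_▹_ : (Fin n → Fin n → ℤ) → (Fin n → ℤ) → Fin n → ℤ
(M ▹ f) u = sum (λ v → M u v * f v)

▹-cong : ∀ (M : Fin n → Fin n → ℤ) {f g} → (∀ v → f v ≡ g v) → ∀ u → (M ▹ f) u ≡ (M ▹ g) u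
▹-cong M f≗g u = sum-cong-≗ (λ v → cong (M u v *_) (f≗g v))

▹-linear : ∀ (M : Fin n → Fin n → ℤ) a b f g u →
  (M ▹ (λ v → a * f v + b * g v)) u ≡ a * (M ▹ f) u + b * (M ▹ g) u
▹-linear M a b f g u = trans (sum-cong-≗ (λ v → lemma (M u v) a b (f v) (g v)))
  (sum-linear a b (λ v → M u v * f v) (λ v → M u v * g v))
  where
  lemma : ∀ m a b x y → m * (a * x + b * y) ≡ a * (m * x) + b * (m * y)
  lemma = solve-∀

▹-assoc : ∀ (r : Fin n → ℤ) (M : Fin n → Fin n → ℤ) f →
  sum (λ v → sum (λ w → r w * M w v) * f v) ≡ sum (λ w → r w * (M ▹ f) w)
▹-assoc r M f = begin
  sum (λ v → sum (λ w → r w * M w v) * f v)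
    ≡⟨ sum-cong-≗ (λ v → *-distribʳ-sum (f v) (λ w → r w * M w v)) ⟩
  sum (λ v → sum (λ w → r w * M w v * f v))
    ≡⟨ ∑-comm (λ v w → r w * M w v * f v) ⟩
  sum (λ w → sum (λ v → r w * M w v * f v))
    ≡⟨ sum-cong-≗ (λ w → trans (sum-cong-≗ (λ v → ℤ.*-assoc (r w) (M w v) (f v)))
         (sym (*-distribˡ-sum (r w) (λ v → M w v * f v)))) ⟩
  sum (λ w → r w * (M ▹ f) w) ∎

self-adjoint : ∀ (M : Fin n → Fin n → ℤ) → (∀ u v → M u v ≡ M v u) → ∀ f g →
  sum (λ v → f v * (M ▹ g) v) ≡ sum (λ v → (M ▹ f) v * g v)
self-adjoint M M-sym f g = sym (trans
  (sum-cong-≗ (λ v → cong (_* g v) (sum-cong-≗ (λ w →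
     trans (ℤ.*-comm (M v w) (f w)) (cong (f w *_) (M-sym v w))))))
  (▹-assoc f M g))

-- Geometric sums and the Moore bound

geo : ℕ → ℕ → ℕ
geo q zero    = 1
geo q (suc i) = 1 ℕ.+ q ℕ.* geo q i

sum-applyUpTo-* : ∀ q (f : ℕ → ℕ) m →
  ℕ.sum (applyUpTo (λ i → q ℕ.* f i) m) ≡ q ℕ.* ℕ.sum (applyUpTo f m)
sum-applyUpTo-* q f zero    = sym (ℕ.*-zeroʳ q)
sum-applyUpTo-* q f (suc m) = trans (cong (q ℕ.* f 0 ℕ.+_) (sum-applyUpTo-* q (f ∘ suc) m))
  (sym (ℕ.*-distribˡ-+ q (f 0) _))

sum-powers : ∀ q e → ℕ.sum (applyUpTo (q ℕ.^_) (suc e)) ≡ geo q e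
sum-powers q zero    = refl
sum-powers q (suc e) = cong suc (trans (sum-applyUpTo-* q (q ℕ.^_) (suc e)) (cong (q ℕ.*_) (sum-powers q e)))

mooreBound-geo : ∀ q e → mooreBound (suc q) (suc e) ≡ 2 ℕ.* geo q e
mooreBound-geo q e = cong (2 ℕ.*_)
  (trans (cong ℕ.sum (map-applyUpTo (λ i → i) (q ℕ.^_) (suc e))) (sum-powers q e))

-- Walk matrices as polynomials in the adjacency operator

reverse-distance : ∀ {G : Graph n} {u v r} → Distance G u v r → Distance G v u r
reverse-distance (p , short) = reverse p , λ ℓ<r → short ℓ<r ∘ reverse

adjacency : Graph n → Fin n → Fin n → ℤ
adjacency G u v = 𝟙 (adj? G u v)

adjacency-sym : ∀ (G : Graph n) u v → adjacency G u v ≡ adjacency G v u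
adjacency-sym G u v = 𝟙-cong (adj? G u v) (adj? G v u) (symm G) (symm G)

walkMatrix : Graph n → ℕ → Fin n → Fin n → ℤ
walkMatrix G i u v = 𝟙 (walk? G i u v)

-- The operator F_i(A) + F_{i−2}(A) + …, where F_j(A) counts the
-- non-backtracking walks of length j in a (q + 1)-regular graph.  The recursive
-- clause has the shape of ▹-linear.
NB : Graph n → ℕ → ℕ → (Fin n → ℤ) → Fin n → ℤ
NB G q 0             f = f
NB G q 1             f = adjacency G ▹ f
NB G q (suc (suc i)) f = λ u → 1ℤ * (adjacency G ▹ NB G q (suc i) f) u + - (+ q) * NB G q i f u

NB-adjacency : ∀ (G : Graph n) q i f u → NB G q i (adjacency G ▹ f) u ≡ (adjacency G ▹ NB G q i f) u
NB-adjacency G q 0 f u = refl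
NB-adjacency G q 1 f u = refl
NB-adjacency G q (suc (suc i)) f u = trans
  (cong₂ (λ x y → 1ℤ * x + - (+ q) * y)
    (▹-cong (adjacency G) (NB-adjacency G q (suc i) f) u) (NB-adjacency G q i f u))
  (sym (▹-linear (adjacency G) 1ℤ (- (+ q)) (adjacency G ▹ NB G q (suc i) f) (NB G q i f) u))

module Girth {n : ℕ} (G : Graph n) (q e : ℕ) (regular : Regular (suc q) G)
  (girth≥ : ∀ m → Cycle G m → 2 ℕ.* suc e ≤ m) where

  private
    A : Fin n → Fin n → ℤ
    A = adjacency G

    p : ℕ → Fin n → Fin n → ℤ
    p = walkMatrix G

  row-sum-A : ∀ u → sum (A u) ≡ + suc q
  row-sum-A u = trans (sym (length-filter (adj? G u) (λ v → v))) (cong +_ (regular u))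

  -- The left side counts the neighbours of `u` that reach `v` in `i + 1` steps. If `u` reaches `v`
  -- in `i` steps, all `q + 1` neighbours do, by first returning to `u`. Otherwise `forget-first`
  -- allows at most one, and there is one exactly when `u` reaches `v` in `i + 2` steps.
  p-rec : ∀ i → 2 ℕ.+ i ≤ e → ∀ u v →
    sum (λ w → A u w * p (suc i) w v) ≡ p (2 ℕ.+ i) u v + + q * p i u v
  p-rec i i≤e u v with walk? G i u v
  ... | yes r = begin
    sum (λ w → A u w * p (suc i) w v) ≡⟨ sum-cong-≗ term ⟩
    sum (A u)                         ≡⟨ row-sum-A u ⟩
    + suc q                           ≡⟨ cong (_+_ 1ℤ) (sym (ℤ.*-identityʳ (+ q))) ⟩
    1ℤ + + q * 1ℤ                     ≡⟨ cong (λ x → x + + q * 1ℤ) (sym (𝟙-yes (walk? G (2 ℕ.+ i) u v) longer)) ⟩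
    p (2 ℕ.+ i) u v + + q * 1ℤ        ∎
    where
    term : ∀ w → A u w * p (suc i) w v ≡ A u w
    term w with adj? G u w
    ... | yes a = trans (ℤ.*-identityˡ _) (𝟙-yes (walk? G (suc i) w v) (symm G a ∷ r))
    ... | no _  = ℤ.*-zeroˡ (p (suc i) w v)
    -- A neighbour exists because the degree `q + 1` is positive; stepping to it and back lengthens
    -- `r` by two.
    someNeighbour : ∃ λ w → Adj G u w
    someNeighbour with any? (adj? G u)
    ... | yes x = x
    ... | no ¬x = ⊥-elim (0≢1+q
      (trans (sym (sum-zero (A u) (λ w → 𝟙-no (adj? G u w) (λ a → ¬x (w , a))))) (row-sum-A u)))
      where
      0≢1+q : 0ℤ ≢ + suc q
      0≢1+q ()
    longer : Walk G (2 ℕ.+ i) u v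
    longer with _ , a ← someNeighbour = pad a (2+ zero) r
  ... | no ¬r = trans (uniqueNeighbour (walk? G (2 ℕ.+ i) u v)) (sym (trans (cong (_+_ (p (2 ℕ.+ i) u v)) (ℤ.*-zeroʳ (+ q))) (ℤ.+-identityʳ _)))
    where
    short : 4 ℕ.+ (i ℕ.+ i) < 2 ℕ.* suc e
    short = ℕ.≤-trans (ℕ.n≤1+n _) (ℕ.≤-trans (ℕ.≤-reflexive (lemma i)) (ℕ.*-monoʳ-≤ 2 (s≤s i≤e)))
      where
      lemma : ∀ i → 6 ℕ.+ (i ℕ.+ i) ≡ 2 ℕ.* (3 ℕ.+ i)
      lemma = ℕsolve-∀
    uniqueNeighbour : Dec (Walk G (2 ℕ.+ i) u v) → sum (λ w → A u w * p (suc i) w v) ≡ p (2 ℕ.+ i) u v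
    uniqueNeighbour (yes (_∷_ {v = x} a s)) = trans (sum-cong-≗ term)
      (trans (sum-δ x (λ _ → 1ℤ)) (sym (𝟙-yes (walk? G (2 ℕ.+ i) u v) (a ∷ s))))
      where
      term : ∀ w → A u w * p (suc i) w v ≡ 𝟙 (x ≟ᶠ w) * 1ℤ
      term w with x ≟ᶠ w
      ... | yes refl = cong₂ _*_ (𝟙-yes (adj? G u x) a) (𝟙-yes (walk? G (suc i) x v) s)
      ... | no x≢w with adj? G u w
      ...   | no _  = ℤ.*-zeroˡ (p (suc i) w v)
      ...   | yes b = cong (1ℤ *_) (𝟙-no (walk? G (suc i) w v)
                        (λ t → ¬r (forget-first girth≥ a b x≢w s t short)))
    uniqueNeighbour (no ¬s) = trans (sum-zero (λ w → A u w * p (suc i) w v) term)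
      (sym (𝟙-no (walk? G (2 ℕ.+ i) u v) ¬s))
      where
      term : ∀ w → A u w * p (suc i) w v ≡ 0ℤ
      term w with adj? G u w
      ... | no _  = ℤ.*-zeroˡ (p (suc i) w v)
      ... | yes b = cong (1ℤ *_) (𝟙-no (walk? G (suc i) w v) (λ t → ¬s (b ∷ t)))

  -- Solved for its top term, `p-rec` is the recursion of `NB`.
  p▹ : ∀ i → i ≤ e → ∀ f u → (p i ▹ f) u ≡ NB G q i f u
  p▹ 0 _ f u = sum-δ u f
  p▹ 1 _ f u = sum-cong-≗ (λ v → cong (_* f v)
    (𝟙-cong (walk? G 1 u v) (adj? G u v) (λ { (a ∷ []) → a }) (λ a → a ∷ [])))
  p▹ (suc (suc i)) i≤e f u = begin
    sum (λ v → p (2 ℕ.+ i) u v * f v)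
      ≡⟨ sum-cong-≗ (λ v → trans (cong (_* f v) (solveFor _ (p (2 ℕ.+ i) u v) _ (p-rec i i≤e u v)))
           (dist (+ q) (sum (λ w → A u w * p (suc i) w v)) (p i u v) (f v))) ⟩
    sum (λ v → 1ℤ * (sum (λ w → A u w * p (suc i) w v) * f v) + - (+ q) * (p i u v * f v))
      ≡⟨ sum-linear 1ℤ (- (+ q)) (λ v → sum (λ w → A u w * p (suc i) w v) * f v) (λ v → p i u v * f v) ⟩
    1ℤ * sum (λ v → sum (λ w → A u w * p (suc i) w v) * f v) + - (+ q) * (p i ▹ f) u
      ≡⟨ cong₂ (λ x y → 1ℤ * x + - (+ q) * y)
           (trans (▹-assoc (A u) (p (suc i)) f)
                  (▹-cong A (p▹ (suc i) (ℕ.≤-trans (ℕ.n≤1+n _) i≤e) f) u))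
           (p▹ i (ℕ.≤-trans (ℕ.m≤n+m i 2) i≤e) f u) ⟩
    NB G q (2 ℕ.+ i) f u ∎
    where
    solveFor : ∀ x y z → x ≡ y + z → y ≡ x + - z
    solveFor _ y z refl = lemma y z
      where
      lemma : ∀ y z → y ≡ y + z + - z
      lemma = solve-∀
    dist : ∀ q x y f → (x + - (q * y)) * f ≡ 1ℤ * (x * f) + - q * (y * f)
    dist = solve-∀

  -- On constants `A` acts as `q + 1`, and geometric sums satisfy
  -- `(q + 1) g(i+1) - q g(i) = g(i+2)`.
  NB-one : ∀ i u → NB G q i (λ _ → 1ℤ) u ≡ + geo q i
  NB-one 0 u = refl
  NB-one 1 u = trans (sum-cong-≗ (λ v → ℤ.*-identityʳ (A u v)))
    (trans (row-sum-A u) (cong (λ x → + suc x) (sym (ℕ.*-identityʳ q))))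
  NB-one (suc (suc i)) u = trans
    (cong₂ (λ x y → 1ℤ * x + - (+ q) * y)
      (trans (▹-cong A (NB-one (suc i)) u)
        (trans (sym (*-distribʳ-sum (+ geo q (suc i)) (A u))) (cong (_* + geo q (suc i)) (row-sum-A u))))
      (NB-one i u))
    (trans (cong₂ (λ x y → 1ℤ * ((1ℤ + + q) * x) + y) (geo-suc i) refl)
      (trans (lemma (+ q) (+ geo q i))
        (sym (trans (geo-suc (suc i)) (cong (λ x → 1ℤ + + q * x) (geo-suc i))))))
    where
    geo-suc : ∀ i → + geo q (suc i) ≡ 1ℤ + + q * + geo q i
    geo-suc i = cong (_+_ 1ℤ) (ℤ.pos-* q (geo q i))
    lemma : ∀ q x → 1ℤ * ((1ℤ + q) * (1ℤ + q * x)) + - q * x ≡ 1ℤ + q * (1ℤ + q * x)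
    lemma = solve-∀

  row-sum-p : ∀ u → sum (p e u) ≡ + geo q e
  row-sum-p u = trans (sum-cong-≗ (λ v → sym (ℤ.*-identityʳ (p e u v))))
    (trans (p▹ e ℕ.≤-refl (λ _ → 1ℤ) u) (NB-one e u))

-- The excess graph

𝟙-⊎ : ∀ {P Q : Set} (p? : Dec P) (q? : Dec Q) → ¬ (P × Q) → 𝟙 (p? ⊎-dec q?) ≡ 𝟙 p? + 𝟙 q?
𝟙-⊎ (yes p) (yes q) ¬both = ⊥-elim (¬both (p , q))
𝟙-⊎ (yes p) (no _)  ¬both = refl
𝟙-⊎ (no _)  (yes q) ¬both = refl
𝟙-⊎ (no _)  (no _)  ¬both = refl

𝟙-disjoint : ∀ {P Q : Set} (p? : Dec P) (q? : Dec Q) → ¬ (P × Q) → 0ℤ ℤ.≤ 1ℤ - (𝟙 p? + 𝟙 q?)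
𝟙-disjoint (yes p) (yes q) ¬both = ⊥-elim (¬both (p , q))
𝟙-disjoint (yes p) (no _)  ¬both = ℤ.+≤+ z≤n
𝟙-disjoint (no _)  (yes q) ¬both = ℤ.+≤+ z≤n
𝟙-disjoint (no _)  (no _)  ¬both = ℤ.+≤+ z≤n

sum-complement : ∀ {n} (f g : Fin n → ℤ) → sum (λ i → 1ℤ - (f i + g i)) ≡ + n - (sum f + sum g)
sum-complement {zero}  f g = refl
sum-complement {suc n} f g = trans (cong (_+_ (1ℤ - (f zero + g zero))) (sum-complement (f ∘ suc) (g ∘ suc)))
  (lemma (f zero) (g zero) (+ n) (sum (f ∘ suc)) (sum (g ∘ suc)))
  where
  lemma : ∀ a b m x y → 1ℤ - (a + b) + (m - (x + y)) ≡ 1ℤ + m - (a + x + (b + y))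
  lemma = solve-∀

-- The parameter `odd` says that `e` is odd, hence so is the extremal distance `2 + e`. The maps
-- `next` and `prev` give the two neighbours of a vertex in the excess graph.
module CyclicExcess {n : ℕ} (G : Graph n) (q e : ℕ) (5≤q : 5 ≤ q) (odd : Even (suc e))
  (regular : Regular (suc q) G) (girth≥ : ∀ m → Cycle G m → 2 ℕ.* suc e ≤ m)
  (order : n ≡ 2 ℕ.* geo q e ℕ.+ 4)
  (next prev : Fin n → Fin n) (next≢prev : ∀ u → next u ≢ prev u)
  (far-next : ∀ u → Distance G u (next u) (2 ℕ.+ e))
  (far-prev : ∀ u → Distance G u (prev u) (2 ℕ.+ e))
  (far-only : ∀ u v → Distance G u v (2 ℕ.+ e) → v ≡ next u ⊎ v ≡ prev u) where

  open Girth G q e regular girth≥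

  private
    A : Fin n → Fin n → ℤ
    A = adjacency G

    p : Fin n → Fin n → ℤ
    p = walkMatrix G e

  -- In the bipartite case C would be the indicator of lying on opposite sides;
  -- C-edge gets what is needed from that by counting.
  E C : Fin n → Fin n → ℤ
  E u v = 𝟙 (distance? G u v (2 ℕ.+ e))
  C u v = 𝟙 (walk? G e u v ⊎-dec distance? G u v (2 ℕ.+ e))

  E-sym : ∀ u v → E u v ≡ E v u
  E-sym u v = 𝟙-cong (distance? G u v (2 ℕ.+ e)) (distance? G v u (2 ℕ.+ e)) reverse-distance reverse-distance

  C-sym : ∀ u v → C u v ≡ C v u
  C-sym u v = 𝟙-cong (walk? G e u v ⊎-dec distance? G u v (2 ℕ.+ e)) (walk? G e v u ⊎-dec distance? G v u (2 ℕ.+ e))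
    (map reverse reverse-distance) (map reverse reverse-distance)

  C≡p+E : ∀ u v → C u v ≡ p u v + E u v
  C≡p+E u v = 𝟙-⊎ (walk? G e u v) (distance? G u v (2 ℕ.+ e))
    (λ (w , d) → proj₂ d (ℕ.m≤n⇒m≤1+n ℕ.≤-refl) w)

  E▹ : ∀ f u → (E ▹ f) u ≡ f (next u) + f (prev u)
  E▹ f u = begin
    sum (λ v → E u v * f v)
      ≡⟨ sum-cong-≗ (λ v → trans (cong (_* f v) (split v)) (ℤ.*-distribʳ-+ (f v) (𝟙 (next u ≟ᶠ v)) (𝟙 (prev u ≟ᶠ v)))) ⟩
    sum (λ v → 𝟙 (next u ≟ᶠ v) * f v + 𝟙 (prev u ≟ᶠ v) * f v)
      ≡⟨ ∑-distrib-+ (λ v → 𝟙 (next u ≟ᶠ v) * f v) (λ v → 𝟙 (prev u ≟ᶠ v) * f v) ⟩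
    sum (λ v → 𝟙 (next u ≟ᶠ v) * f v) + sum (λ v → 𝟙 (prev u ≟ᶠ v) * f v)
      ≡⟨ cong₂ _+_ (sum-δ (next u) f) (sum-δ (prev u) f) ⟩
    f (next u) + f (prev u) ∎
    where
    split : ∀ v → E u v ≡ 𝟙 (next u ≟ᶠ v) + 𝟙 (prev u ≟ᶠ v)
    split v = trans
      (𝟙-cong (distance? G u v (2 ℕ.+ e)) ((next u ≟ᶠ v) ⊎-dec (prev u ≟ᶠ v))
        (map sym sym ∘ far-only u v)
        λ { (inj₁ refl) → far-next u ; (inj₂ refl) → far-prev u })
      (𝟙-⊎ (next u ≟ᶠ v) (prev u ≟ᶠ v) (λ (r , s) → next≢prev u (trans r (sym s))))

  E▹C : ∀ f u → (E ▹ f) u ≡ (C ▹ f) u - NB G q e f u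
  E▹C f u = begin
    (E ▹ f) u                                       ≡⟨ sym (xyx⁻¹≈y ((p ▹ f) u) ((E ▹ f) u)) ⟩
    (p ▹ f) u + (E ▹ f) u - (p ▹ f) u   ≡⟨ cong₂ _-_ (sym C▹) (p▹ e ℕ.≤-refl f u) ⟩
    (C ▹ f) u - NB G q e f u                        ∎
    where
    C▹ : (C ▹ f) u ≡ (p ▹ f) u + (E ▹ f) u
    C▹ = trans (sum-cong-≗ (λ v → trans (cong (_* f v) (C≡p+E u v)) (ℤ.*-distribʳ-+ (f v) (p u v) (E u v))))
      (∑-distrib-+ (λ v → p u v * f v) (λ v → E u v * f v))

  order-ℤ : + n ≡ + geo q e + + geo q e + + 4
  order-ℤ = cong +_ (trans order (cong (ℕ._+ 4) (cong (geo q e ℕ.+_) (ℕ.+-identityʳ (geo q e)))))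

  ¬both-near : ∀ {u w z} → Adj G u w → ¬ (Walk G e u z × Walk G e w z)
  ¬both-near a (r , s) = ¬both-ends girth≥ a r s (ℕ.≤-reflexive (lemma e))
    where
    lemma : ∀ e → 2 ℕ.+ (e ℕ.+ e) ≡ 2 ℕ.* suc e
    lemma = ℕsolve-∀

  -- Only n − M = 4 vertices z have no walk of length e to either end of an edge,
  -- but all k neighbours of a vertex far from both ends would be among them.
  ¬both-far : ∀ {u w v} → Adj G u w → Distance G u v (2 ℕ.+ e) → ¬ Distance G w v (2 ℕ.+ e)
  ¬both-far {u} {w} {v} a (_ , u-far) (_ , w-far) =
    ℕ.<⇒≱ (s≤s 5≤q) (ℕ.≤-trans (ℤ.drop‿+≤+ degree≤4) (ℕ.n≤1+n 4))
    where
    uncovered : Fin n → ℤ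
    uncovered z = 1ℤ - (p u z + p w z)
    count : sum uncovered ≡ + 4
    count = begin
      sum uncovered                         ≡⟨ sum-complement (p u) (p w) ⟩
      + n - (sum (p u) + sum (p w))
        ≡⟨ cong₂ (λ x y → x - y) order-ℤ (cong₂ _+_ (row-sum-p u) (row-sum-p w)) ⟩
      + geo q e + + geo q e + + 4 - (+ geo q e + + geo q e) ≡⟨ lemma (+ geo q e) (+ 4) ⟩
      + 4 ∎
      where
      lemma : ∀ x y → x + x + y - (x + x) ≡ y
      lemma = solve-∀
    -- A neighbour of `v` with a walk of length `e` to `u` or `w` would put `v` within `e + 1` steps
    -- of that end.
    bound : ∀ z → A v z ℤ.≤ uncovered z
    bound z with adj? G v z
    ... | no _  = 𝟙-disjoint (walk? G e u z) (walk? G e w z) (¬both-near a)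
    ... | yes b = ℤ.≤-reflexive (sym (cong₂ (λ x y → 1ℤ - (x + y))
      (𝟙-no (walk? G e u z) (λ r → u-far ℕ.≤-refl (snoc r (symm G b))))
      (𝟙-no (walk? G e w z) (λ r → w-far ℕ.≤-refl (snoc r (symm G b))))))
    degree≤4 : + suc q ℤ.≤ + 4
    degree≤4 = ℤ.≤-trans (ℤ.≤-reflexive (sym (row-sum-A v)))
      (ℤ.≤-trans (sum-mono-≤ (A v) uncovered bound) (ℤ.≤-reflexive count))

  -- The `2` counts `next u` and `prev u`; the total is half the order.
  row-sum-C : ∀ u → sum (C u) ≡ + geo q e + + 2
  row-sum-C u = begin
    sum (C u)                                ≡⟨ sum-cong-≗ (C≡p+E u) ⟩
    sum (λ v → p u v + E u v)          ≡⟨ ∑-distrib-+ (p u) (E u) ⟩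
    sum (p u) + sum (E u)              ≡⟨ cong₂ _+_ (row-sum-p u)
      (trans (sum-cong-≗ (λ v → sym (ℤ.*-identityʳ (E u v)))) (E▹ (λ _ → 1ℤ) u)) ⟩
    + geo q e + + 2 ∎

  -- The rows of C at adjacent vertices have disjoint supports, each of size n / 2.
  C-edge : ∀ {u w} → Adj G u w → ∀ v → C u v + C w v ≡ 1ℤ
  C-edge {u} {w} a v = sym (x∙y⁻¹≈ε⇒x≈y 1ℤ (C u v + C w v) (sum≡0⇒≡0 gap gap≥0 gap-sum v))
    where
    gap : Fin n → ℤ
    gap z = 1ℤ - (C u z + C w z)
    gap≥0 : ∀ z → 0ℤ ℤ.≤ gap z
    gap≥0 z = 𝟙-disjoint (walk? G e u z ⊎-dec distance? G u z (2 ℕ.+ e)) (walk? G e w z ⊎-dec distance? G w z (2 ℕ.+ e))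
      λ { (inj₁ r , inj₁ s)           → ¬both-near a (r , s)
        ; (inj₁ r , inj₂ (_ , w-far)) → w-far ℕ.≤-refl (symm G a ∷ r)
        ; (inj₂ (_ , u-far) , inj₁ s) → u-far ℕ.≤-refl (a ∷ s)
        ; (inj₂ d , inj₂ d′)          → ¬both-far a d d′ }
    gap-sum : sum gap ≡ 0ℤ
    gap-sum = begin
      sum gap                         ≡⟨ sum-complement (C u) (C w) ⟩
      + n - (sum (C u) + sum (C w))
        ≡⟨ cong₂ (λ x y → x - y) order-ℤ (cong₂ _+_ (row-sum-C u) (row-sum-C w)) ⟩
      + geo q e + + geo q e + + 4 - (+ geo q e + + 2 + (+ geo q e + + 2)) ≡⟨ lemma (+ geo q e) ⟩
      0ℤ ∎
      where
      lemma : ∀ x → x + x + + 4 - (x + + 2 + (x + + 2)) ≡ 0ℤ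
      lemma = solve-∀

  -- Each edge complements the row of `C`, so two consecutive edges restore it.
  C-even-walk : ∀ {ℓ u w} → Even ℓ → Walk G ℓ u w → ∀ v → C u v ≡ C w v
  C-even-walk zero   []          v = refl
  C-even-walk (2+ x) (_∷_ {u = u} {v = m} a (_∷_ {v = w} b r)) v = trans
    (∙-cancelʳ (C m v) (C u v) (C w v)
      (trans (C-edge a v) (sym (trans (ℤ.+-comm (C w v) (C m v)) (C-edge b v)))))
    (C-even-walk x r v)

  -- The first edge of a walk of length `2 + e` complements the row, and the remaining `e + 1`
  -- edges, an even number, preserve it.
  C-far : ∀ {u w} → Distance G u w (2 ℕ.+ e) → ∀ v → C u v + C w v ≡ 1ℤ
  C-far {u} {w} (a ∷ r , _) v = trans (cong (λ x → C u v + x) (sym (C-even-walk odd r v))) (C-edge a v)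

  -- The eigenvalue - 1 of the excess graph

  EigenE : (Fin n → ℤ) → Set
  EigenE f = ∀ u → (E ▹ f) u ≡ - f u

  module _ (f : Fin n → ℤ) (eigen : EigenE f) where

    -- Symmetry moves `E` from `r` onto the eigenfunction.
    pairing : ∀ (r : Fin n → ℤ) → sum (λ v → (E ▹ r) v * f v) ≡ - sum (λ v → r v * f v)
    pairing r = begin
      sum (λ v → (E ▹ r) v * f v)       ≡⟨ sym (self-adjoint E E-sym r f) ⟩
      sum (λ v → r v * (E ▹ f) v)       ≡⟨ sum-cong-≗ (λ v → trans (cong (r v *_) (eigen v)) (lemma (r v) (f v))) ⟩
      sum (λ v → - 1ℤ * (r v * f v))    ≡⟨ sym (*-distribˡ-sum (- 1ℤ) (λ v → r v * f v)) ⟩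
      - 1ℤ * sum (λ v → r v * f v)      ≡⟨ ℤ.-1*i≡-i _ ⟩
      - sum (λ v → r v * f v) ∎
      where
      lemma : ∀ x y → x * - y ≡ - 1ℤ * (x * y)
      lemma = solve-∀

    -- Since `E` sends the constant `1` to `2`, pairing with it gives `2 s = - s` for the sum `s`.
    eigen-sum : sum f ≡ 0ℤ
    eigen-sum = ℤ.*-cancelˡ-≡ (+ 3) (sum f) 0ℤ (begin
      + 3 * sum f              ≡⟨ split (sum f) ⟩
      + 2 * sum f + sum f      ≡⟨ cong (λ x → x + sum f) (trans (*-distribˡ-sum (+ 2) f)
        (trans (sum-cong-≗ (λ v → cong (_* f v) (sym (E▹ (λ _ → 1ℤ) v)))) (pairing (λ _ → 1ℤ)))) ⟩
      - sum (λ v → 1ℤ * f v) + sum f ≡⟨ cong (λ x → - x + sum f) (sum-cong-≗ (λ v → ℤ.*-identityˡ (f v))) ⟩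
      - sum f + sum f          ≡⟨ ℤ.+-inverseˡ (sum f) ⟩
      0ℤ                       ∎)
      where
      split : ∀ x → + 3 * x ≡ + 2 * x + x
      split = solve-∀

    E▹C-row : ∀ u v → (E ▹ C u) v ≡ + 2 - + 2 * C u v
    E▹C-row u v = begin
      (E ▹ C u) v                      ≡⟨ E▹ (C u) v ⟩
      C u (next v) + C u (prev v)      ≡⟨ cong₂ _+_ (flip (far-next v)) (flip (far-prev v)) ⟩
      1ℤ - C u v + (1ℤ - C u v)        ≡⟨ lemma (C u v) ⟩
      + 2 - + 2 * C u v                ∎
      where
      lemma : ∀ x → 1ℤ - x + (1ℤ - x) ≡ + 2 - + 2 * x
      lemma = solve-∀
      flip : ∀ {w} → Distance G v w (2 ℕ.+ e) → C u w ≡ 1ℤ - C u v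
      flip {w} d = trans (sym (xyx⁻¹≈y (C u v) (C u w)))
        (cong (λ x → x - C u v) (trans (cong₂ _+_ (C-sym u v) (C-sym u w)) (C-far d u)))

    sum-affine : ∀ a b (r : Fin n → ℤ) → sum (λ v → (a - b * r v) * f v) ≡ - b * sum (λ v → r v * f v)
    sum-affine a b r = begin
      sum (λ v → (a - b * r v) * f v)                 ≡⟨ sum-cong-≗ (λ v → lemma a b (r v) (f v)) ⟩
      sum (λ v → a * f v + - b * (r v * f v))         ≡⟨ sum-linear a (- b) f (λ v → r v * f v) ⟩
      a * sum f + - b * sum (λ v → r v * f v)         ≡⟨ cong (λ x → a * x + - b * sum (λ v → r v * f v)) eigen-sum ⟩
      a * 0ℤ + - b * sum (λ v → r v * f v)            ≡⟨ cong (_+ - b * sum (λ v → r v * f v)) (ℤ.*-zeroʳ a) ⟩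
      0ℤ + - b * sum (λ v → r v * f v)                ≡⟨ ℤ.+-identityˡ _ ⟩
      - b * sum (λ v → r v * f v) ∎
      where
      lemma : ∀ a b r x → (a - b * r) * x ≡ a * x + - b * (r * x)
      lemma = solve-∀

    -- Let `x` be the value in question. Pairing `f` with `E ▹ C u` gives `- x` by symmetry of `E`,
    -- and `- 2 x` by `E▹C-row`, whose constant part vanishes by `eigen-sum`.
    C▹eigen : ∀ u → (C ▹ f) u ≡ 0ℤ
    C▹eigen u = cancel ((C ▹ f) u) (trans (sym (sum-affine (+ 2) (+ 2) (C u)))
      (trans (sum-cong-≗ (λ v → cong (_* f v) (sym (E▹C-row u v)))) (pairing (C u))))
      where
      cancel : ∀ x → - + 2 * x ≡ - x → x ≡ 0ℤ
      cancel x eq = trans (lemma x) (trans (cong (λ y → - x - y) eq) (ℤ.+-inverseʳ (- x)))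
        where
        lemma : ∀ x → x ≡ - x - - + 2 * x
        lemma = solve-∀

    -- `C` is the sum of `P_e(A)` and `E`; it kills `f`, while `E` negates it.
    NB-eigen : ∀ u → NB G q e f u ≡ f u
    NB-eigen u = begin
      NB G q e f u                                ≡⟨ lemma ((C ▹ f) u) (NB G q e f u) ⟩
      (C ▹ f) u - ((C ▹ f) u - NB G q e f u)      ≡⟨ cong₂ _-_ (C▹eigen u) (trans (sym (E▹C f u)) (eigen u)) ⟩
      0ℤ - - f u                                  ≡⟨ lemma′ (f u) ⟩
      f u                                         ∎
      where
      lemma : ∀ x y → y ≡ x - (x - y)
      lemma = solve-∀
      lemma′ : ∀ x → 0ℤ - - x ≡ x
      lemma′ = solve-∀

    -- By `C-edge`, `A` sends the row `C u` to `k - k C u` with `k = q + 1`, so the value is a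
    -- multiple of `(C ▹ f) u`.
    C▹A▹eigen : ∀ u → (C ▹ A ▹ f) u ≡ 0ℤ
    C▹A▹eigen u = begin
      (C ▹ A ▹ f) u                                  ≡⟨ self-adjoint A (adjacency-sym G) (C u) f ⟩
      sum (λ v → (A ▹ C u) v * f v)                  ≡⟨ sum-cong-≗ (λ v → cong (_* f v) (A▹C-row v)) ⟩
      sum (λ v → (+ suc q - + suc q * C u v) * f v)  ≡⟨ sum-affine (+ suc q) (+ suc q) (C u) ⟩
      - + suc q * (C ▹ f) u                          ≡⟨ cong (- + suc q *_) (C▹eigen u) ⟩
      - + suc q * 0ℤ                                 ≡⟨ ℤ.*-zeroʳ (- + suc q) ⟩
      0ℤ ∎
      where
      A▹C-row : ∀ v → (A ▹ C u) v ≡ + suc q - + suc q * C u v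
      A▹C-row v = begin
        sum (λ w → A v w * C u w)          ≡⟨ sum-cong-≗ term ⟩
        sum (λ w → A v w * (1ℤ - C u v))   ≡⟨ sym (*-distribʳ-sum (1ℤ - C u v) (A v)) ⟩
        sum (A v) * (1ℤ - C u v)           ≡⟨ cong (_* (1ℤ - C u v)) (row-sum-A v) ⟩
        + suc q * (1ℤ - C u v)             ≡⟨ lemma (+ suc q) (C u v) ⟩
        + suc q - + suc q * C u v          ∎
        where
        lemma : ∀ k x → k * (1ℤ - x) ≡ k - k * x
        lemma = solve-∀
        term : ∀ w → A v w * C u w ≡ A v w * (1ℤ - C u v)
        term w with adj? G v w
        ... | no _  = refl
        ... | yes a = cong (1ℤ *_) (trans (sym (xyx⁻¹≈y (C u v) (C u w)))
          (cong (λ x → x - C u v) (trans (cong₂ _+_ (C-sym u v) (C-sym u w)) (C-edge a u))))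

    -- `A` commutes with `P_e(A)`, which fixes `f`, and `C` kills `A ▹ f`; hence `E = C - P_e(A)`
    -- negates `A ▹ f`.
    A▹eigen : EigenE (A ▹ f)
    A▹eigen u = begin
      (E ▹ A ▹ f) u                           ≡⟨ E▹C (A ▹ f) u ⟩
      (C ▹ A ▹ f) u - NB G q e (A ▹ f) u      ≡⟨ cong₂ _-_ (C▹A▹eigen u) (trans (NB-adjacency G q e f u) (▹-cong A NB-eigen u)) ⟩
      0ℤ - (A ▹ f) u                          ≡⟨ ℤ.+-identityˡ _ ⟩
      - (A ▹ f) u                             ∎

-- Cycle positions and the eigenvalue − 1

cyclicSucc-functional : ∀ {m} {i j j′ : Fin m} → CyclicSucc i j → CyclicSucc i j′ → j ≡ j′
cyclicSucc-functional (inj₁ r) (inj₁ s) = toℕ-injective (trans (sym r) s)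
cyclicSucc-functional {j = j} (inj₁ r) (inj₂ (s , _)) = ⊥-elim (ℕ.<⇒≢ (toℕ<n j) (trans (sym r) s))
cyclicSucc-functional {j′ = j} (inj₂ (s , _)) (inj₁ r) = ⊥-elim (ℕ.<⇒≢ (toℕ<n j) (trans (sym r) s))
cyclicSucc-functional (inj₂ (_ , r)) (inj₂ (_ , s)) = toℕ-injective (trans r (sym s))

cyclicSucc-injective : ∀ {m} {i i′ j : Fin m} → CyclicSucc i j → CyclicSucc i′ j → i ≡ i′
cyclicSucc-injective (inj₁ r) (inj₁ s) = toℕ-injective (ℕ.suc-injective (trans r (sym s)))
cyclicSucc-injective (inj₁ r) (inj₂ (_ , s)) = ⊥-elim (ℕ.1+n≢0 (trans r s))
cyclicSucc-injective (inj₂ (_ , s)) (inj₁ r) = ⊥-elim (ℕ.1+n≢0 (trans r s))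
cyclicSucc-injective (inj₂ (r , _)) (inj₂ (s , _)) = toℕ-injective (ℕ.suc-injective (trans r (sym s)))

cyclicSucc-asym : ∀ {m} → 3 ≤ m → {i j : Fin m} → CyclicSucc i j → ¬ CyclicSucc j i
cyclicSucc-asym 3≤m (inj₁ r) (inj₁ s) = ℕ.m≢1+n+m _ (sym (trans (cong suc r) s))
cyclicSucc-asym 3≤m (inj₁ r) (inj₂ (s , i≡0)) =
  ℕ.<⇒≢ 3≤m (trans (cong suc (trans (cong suc (sym i≡0)) r)) s)
cyclicSucc-asym 3≤m (inj₂ (s , j≡0)) (inj₁ r) =
  ℕ.<⇒≢ 3≤m (trans (cong suc (trans (cong suc (sym j≡0)) r)) s)
cyclicSucc-asym 3≤m (inj₂ (s , _)) (inj₂ (_ , i≡0)) =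
  ℕ.<⇒≢ (ℕ.≤-trans (s≤s (s≤s z≤n)) 3≤m) (trans (cong suc (sym i≡0)) s)

cyclicSuccessor : ∀ {m} (i : Fin m) → ∃ λ j → CyclicSucc i j
cyclicSuccessor {suc m} i with suc (toℕ i) ℕ.<? suc m
... | yes i<m = fromℕ< i<m , inj₁ (sym (toℕ-fromℕ< i<m))
... | no i≮m  = zero , inj₂ (ℕ.≤-antisym (toℕ<n i) (ℕ.≮⇒≥ i≮m) , refl)

cyclicPredecessor : ∀ {m} (j : Fin m) → ∃ λ i → CyclicSucc i j
cyclicPredecessor {suc m} zero    = fromℕ m , inj₂ (cong suc (toℕ-fromℕ m) , refl)
cyclicPredecessor {suc m} (suc j) = inject₁ j , inj₁ (cong suc (toℕ-inject₁ j))

-- The sequence repeats `x`, `y`, `- x - y`: the recurrence has characteristic polynomial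
-- `z² + z + 1`.
wave : ℤ → ℤ → ℕ → ℤ
wave x y 0             = x
wave x y 1             = y
wave x y (suc (suc i)) = - wave x y (suc i) - wave x y i

wave-linear : ∀ x y i → wave x y i ≡ x * wave 1ℤ 0ℤ i + y * wave 0ℤ 1ℤ i
wave-linear x y 0 = lemma x y
  where
  lemma : ∀ x y → x ≡ x * 1ℤ + y * 0ℤ
  lemma = solve-∀
wave-linear x y 1 = lemma x y
  where
  lemma : ∀ x y → y ≡ x * 0ℤ + y * 1ℤ
  lemma = solve-∀
wave-linear x y (suc (suc i)) = trans
  (cong₂ (λ a b → - a - b) (wave-linear x y (suc i)) (wave-linear x y i))
  (lemma x y (wave 1ℤ 0ℤ (suc i)) (wave 1ℤ 0ℤ i) (wave 0ℤ 1ℤ (suc i)) (wave 0ℤ 1ℤ i))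
  where
  lemma : ∀ x y a b c d → - (x * a + y * c) - (x * b + y * d) ≡ x * (- a - b) + y * (- c - d)
  lemma = solve-∀

wave-periodic : ∀ x y t i → wave x y (t ℕ.* 3 ℕ.+ i) ≡ wave x y i
wave-periodic x y zero    i = refl
wave-periodic x y (suc t) i = trans (lemma (wave x y (suc (t ℕ.* 3 ℕ.+ i))) (wave x y (t ℕ.* 3 ℕ.+ i)))
  (wave-periodic x y t i)
  where
  lemma : ∀ a b → - (- a - b) - a ≡ b
  lemma = solve-∀

module _ {n : ℕ} (x y : ℤ) (t : ℕ) (n≡3t : n ≡ t ℕ.* 3) where

  -- Only the wrap-around needs an argument: there period three and `3 ∣ n` identify position `n`
  -- with position `0`. The offset `s` allows two successor steps to be composed.
  wave-succ : ∀ {i j : Fin n} → CyclicSucc i j → ∀ s → wave x y (s ℕ.+ toℕ j) ≡ wave x y (s ℕ.+ suc (toℕ i))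
  wave-succ (inj₁ r) s = cong (λ k → wave x y (s ℕ.+ k)) (sym r)
  wave-succ {i} {j} (inj₂ (r , j≡0)) s = begin
    wave x y (s ℕ.+ toℕ j)         ≡⟨ cong (λ k → wave x y (s ℕ.+ k)) j≡0 ⟩
    wave x y (s ℕ.+ 0)             ≡⟨ cong (wave x y) (ℕ.+-identityʳ s) ⟩
    wave x y s                     ≡⟨ sym (wave-periodic x y t s) ⟩
    wave x y (t ℕ.* 3 ℕ.+ s)       ≡⟨ cong (wave x y) (ℕ.+-comm (t ℕ.* 3) s) ⟩
    wave x y (s ℕ.+ t ℕ.* 3)       ≡⟨ cong (λ k → wave x y (s ℕ.+ k)) (sym (trans r n≡3t)) ⟩
    wave x y (s ℕ.+ suc (toℕ i))   ∎

  wave-triple : ∀ {i j k : Fin n} → CyclicSucc i j → CyclicSucc j k →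
    wave x y (toℕ k) + wave x y (toℕ i) ≡ - wave x y (toℕ j)
  wave-triple {i} {j} {k} r s = begin
    wave x y (toℕ k) + wave x y (toℕ i)
      ≡⟨ cong (λ z → z + wave x y (toℕ i)) (trans (wave-succ s 0) (wave-succ r 1)) ⟩
    - wave x y (suc (toℕ i)) - wave x y (toℕ i) + wave x y (toℕ i)
      ≡⟨ lemma (wave x y (suc (toℕ i))) (wave x y (toℕ i)) ⟩
    - wave x y (suc (toℕ i))
      ≡⟨ cong -_ (sym (wave-succ r 0)) ⟩
    - wave x y (toℕ j) ∎
    where
    lemma : ∀ a b → - a - b + b ≡ - a
    lemma = solve-∀

-- Each value follows from the two before it, so positions `0` and `1` determine `f` and the
-- eigenspace has rank at most two.
wave-unique : ∀ {n} (1<n : 1 < n) (f : Fin n → ℤ) →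
  (∀ {i j k} → CyclicSucc i j → CyclicSucc j k → f k + f i ≡ - f j) →
  ∀ i → f i ≡ wave (f (fromℕ< (ℕ.<⇒≤ 1<n))) (f (fromℕ< 1<n)) (toℕ i)
wave-unique {n} 1<n f triple i = go (toℕ i) i refl
  where
  go : ∀ k (i : Fin n) → toℕ i ≡ k →
    f i ≡ wave (f (fromℕ< (ℕ.<⇒≤ 1<n))) (f (fromℕ< 1<n)) k
  go 0 i eq = cong f (toℕ-injective (trans eq (sym (toℕ-fromℕ< (ℕ.<⇒≤ 1<n)))))
  go 1 i eq = cong f (toℕ-injective (trans eq (sym (toℕ-fromℕ< 1<n))))
  go (suc (suc k)) i eq = begin
    f i                                ≡⟨ lemma (f i) (f i₀) ⟩
    f i + f i₀ - f i₀                  ≡⟨ cong (λ z → z - f i₀) (triple {i₀} {i₁} {i} (inj₁ succ₀) (inj₁ succ₁)) ⟩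
    - f i₁ - f i₀                      ≡⟨ cong₂ (λ a b → - a - b) (go (suc k) i₁ (toℕ-fromℕ< 1+k<n)) (go k i₀ (toℕ-fromℕ< k<n)) ⟩
    wave (f (fromℕ< (ℕ.<⇒≤ 1<n))) (f (fromℕ< 1<n)) (2 ℕ.+ k) ∎
    where
    1+k<n : suc k < n
    1+k<n = ℕ.<⇒≤ (subst (_< n) eq (toℕ<n i))
    k<n : k < n
    k<n = ℕ.<⇒≤ 1+k<n
    i₁ i₀ : Fin n
    i₁ = fromℕ< 1+k<n
    i₀ = fromℕ< k<n
    succ₀ : suc (toℕ i₀) ≡ toℕ i₁
    succ₀ = trans (cong suc (toℕ-fromℕ< k<n)) (sym (toℕ-fromℕ< 1+k<n))
    succ₁ : suc (toℕ i₁) ≡ toℕ i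
    succ₁ = trans (cong suc (toℕ-fromℕ< 1+k<n)) (sym eq)
    lemma : ∀ a b → a ≡ a + b - b
    lemma = solve-∀

-- Solutions of P q i (S) = 1

-- NB G q i is P q i applied to the adjacency operator.
P : ℤ → ℕ → ℤ → ℤ
P q 0             x = 1ℤ
P q 1             x = x
P q (suc (suc i)) x = x * P q (suc i) x - q * P q i x

-- P q i reduces to α q t δ i x + β q t δ i modulo x² − t x + δ.
α β : ℤ → ℤ → ℤ → ℕ → ℤ
α q t δ 0             = 0ℤ
α q t δ 1             = 1ℤ
α q t δ (suc (suc i)) = t * α q t δ (suc i) + β q t δ (suc i) - q * α q t δ i
β q t δ 0             = 1ℤ
β q t δ 1             = 0ℤ
β q t δ (suc (suc i)) = - δ * α q t δ (suc i) - q * β q t δ i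

-- `a` is a root of `x² - (a + d) x + a d`, so the remainder and the polynomial agree at `a`.
P-root : ∀ q a d i → α q (a + d) (a * d) i * a + β q (a + d) (a * d) i ≡ P q i a
P-root q a d 0 = lemma a
  where
  lemma : ∀ a → 0ℤ * a + 1ℤ ≡ 1ℤ
  lemma = solve-∀
P-root q a d 1 = lemma a
  where
  lemma : ∀ a → 1ℤ * a + 0ℤ ≡ a
  lemma = solve-∀
P-root q a d (suc (suc i)) = trans
  (lemma q a d (α q (a + d) (a * d) (suc i)) (β q (a + d) (a * d) (suc i)) (α q (a + d) (a * d) i) (β q (a + d) (a * d) i))
  (cong₂ (λ x y → a * x - q * y) (P-root q a d (suc i)) (P-root q a d i))
  where
  lemma : ∀ q a d x y x′ y′ →
    ((a + d) * x + y - q * x′) * a + (- (a * d) * x - q * y′) ≡ a * (x * a + y) - q * (x′ * a + y′)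
  lemma = solve-∀

unit : ∀ a y → a * y ≡ 1ℤ → a ≡ 1ℤ ⊎ a ≡ - 1ℤ
unit a y eq with a | ℕ.m*n≡1⇒m≡1 ℤ.∣ a ∣ ℤ.∣ y ∣ (trans (sym (ℤ.abs-* a y)) (cong ℤ.∣_∣ eq))
... | + _      | refl = inj₁ refl
... | -[1+ _ ] | refl = inj₂ refl

-- A polynomial `P` of odd index contains only odd powers of `x`.
P-odd-divisible : ∀ q i x → ∃ λ y → P q (suc (i ℕ.+ i)) x ≡ x * y
P-odd-divisible q zero x = 1ℤ , sym (ℤ.*-identityʳ x)
P-odd-divisible q (suc i) x rewrite ℕ.+-suc i i with y , eq ← P-odd-divisible q i x =
  P q (2 ℕ.+ (i ℕ.+ i)) x - q * y ,
  trans (cong (λ z → x * P q (2 ℕ.+ (i ℕ.+ i)) x - q * z) eq) (lemma q x (P q (2 ℕ.+ (i ℕ.+ i)) x) y)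
  where
  lemma : ∀ q x z y → x * z - q * (x * y) ≡ x * (z - q * y)
  lemma = solve-∀

P-odd≡1⇒unit : ∀ q i x → P q (suc (i ℕ.+ i)) x ≡ 1ℤ → x ≡ 1ℤ ⊎ x ≡ - 1ℤ
P-odd≡1⇒unit q i x eq with y , eq′ ← P-odd-divisible q i x = unit x y (trans (sym eq′) eq)

sgn : ℕ → ℤ
sgn zero    = 1ℤ
sgn (suc i) = - sgn i

∣sgn∣ : ∀ i → ℤ.∣ sgn i ∣ ≡ 1
∣sgn∣ zero    = refl
∣sgn∣ (suc i) = trans (ℤ.∣-i∣≡∣i∣ (sgn i)) (∣sgn∣ i)

P-neg : ∀ q i x → P q i (- x) ≡ sgn i * P q i x
P-neg q 0 x = refl
P-neg q 1 x = sym (ℤ.-1*i≡-i x)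
P-neg q (suc (suc i)) x = trans (cong₂ (λ u v → - x * u - q * v) (P-neg q (suc i) x) (P-neg q i x))
  (lemma q x (sgn i) (P q (suc i) x) (P q i x))
  where
  lemma : ∀ q x s u v → - x * (- s * u) - q * (s * v) ≡ - - s * (x * u - q * v)
  lemma = solve-∀

-- With `q = 5 + r`, the values at `1` are, up to sign, polynomials in `r` with positive
-- coefficients; the Horner form makes their size visible for `r ≥ 0`.
module _ (r : ℤ) where

  P₂-one : P (+ 5 + r) 2 1ℤ ≡ - (+ 4 + r)
  P₂-one = lemma r
    where
    lemma : ∀ r → 1ℤ * 1ℤ - (+ 5 + r) * 1ℤ ≡ - (+ 4 + r)
    lemma = solve-∀

  P₃-one : P (+ 5 + r) 3 1ℤ ≡ - (+ 9 + r * + 2)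
  P₃-one = trans (cong (λ u → 1ℤ * u - (+ 5 + r) * 1ℤ) P₂-one) (lemma r)
    where
    lemma : ∀ r → 1ℤ * (- (+ 4 + r)) - (+ 5 + r) * 1ℤ ≡ - (+ 9 + r * + 2)
    lemma = solve-∀

  P₄-one : P (+ 5 + r) 4 1ℤ ≡ + 11 + r * (+ 7 + r)
  P₄-one = trans (cong₂ (λ u v → 1ℤ * u - (+ 5 + r) * v) P₃-one P₂-one) (lemma r)
    where
    lemma : ∀ r → 1ℤ * (- (+ 9 + r * + 2)) - (+ 5 + r) * (- (+ 4 + r)) ≡ + 11 + r * (+ 7 + r)
    lemma = solve-∀

  P₅-one : P (+ 5 + r) 5 1ℤ ≡ + 56 + r * (+ 26 + r * + 3)
  P₅-one = trans (cong₂ (λ u v → 1ℤ * u - (+ 5 + r) * v) P₄-one P₃-one) (lemma r)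
    where
    lemma : ∀ r → 1ℤ * (+ 11 + r * (+ 7 + r)) - (+ 5 + r) * (- (+ 9 + r * + 2)) ≡ + 56 + r * (+ 26 + r * + 3)
    lemma = solve-∀

  P₇-one : P (+ 5 + r) 7 1ℤ ≡ - (+ 279 + r * (+ 206 + r * (+ 50 + r * + 4)))
  P₇-one = trans (cong₂ (λ u v → 1ℤ * (1ℤ * u - (+ 5 + r) * v) - (+ 5 + r) * u) P₅-one P₄-one) (lemma r)
    where
    lemma : ∀ r → 1ℤ * (1ℤ * (+ 56 + r * (+ 26 + r * + 3)) - (+ 5 + r) * (+ 11 + r * (+ 7 + r)))
        - (+ 5 + r) * (+ 56 + r * (+ 26 + r * + 3))
      ≡ - (+ 279 + r * (+ 206 + r * (+ 50 + r * + 4)))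
    lemma = solve-∀

-- The form `c + m` with `m` natural displays the lower bound `c`, so that later false equations are
-- refuted by constructors.
horner-positive : ∀ c r {x} → 0ℤ ℤ.≤ x → ∃ λ m → + c + + r * x ≡ + (c ℕ.+ m)
horner-positive c r {+ m} _ = r ℕ.* m , cong (λ y → + c + y) (sym (ℤ.pos-* r m))

horner≥0 : ∀ c r {x} → 0ℤ ℤ.≤ x → 0ℤ ℤ.≤ + c + + r * x
horner≥0 c r x≥0 with _ , eq ← horner-positive c r x≥0 = subst (0ℤ ℤ.≤_) (sym eq) (ℤ.+≤+ z≤n)

∣P₃-one∣ : ∀ r → ∃ λ m → ℤ.∣ P (+ 5 + + r) 3 1ℤ ∣ ≡ 9 ℕ.+ m
∣P₃-one∣ r with m , eq ← horner-positive 9 r {+ 2} (ℤ.+≤+ z≤n) =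
  m , cong ℤ.∣_∣ (trans (P₃-one (+ r)) (cong -_ eq))

∣P₅-one∣ : ∀ r → ∃ λ m → ℤ.∣ P (+ 5 + + r) 5 1ℤ ∣ ≡ 56 ℕ.+ m
∣P₅-one∣ r with m , eq ← horner-positive 56 r (horner≥0 26 r {+ 3} (ℤ.+≤+ z≤n)) =
  m , cong ℤ.∣_∣ (trans (P₅-one (+ r)) eq)

∣P₇-one∣ : ∀ r → ∃ λ m → ℤ.∣ P (+ 5 + + r) 7 1ℤ ∣ ≡ 279 ℕ.+ m
∣P₇-one∣ r with m , eq ← horner-positive 279 r (horner≥0 206 r (horner≥0 50 r {+ 4} (ℤ.+≤+ z≤n))) =
  m , cong ℤ.∣_∣ (trans (P₇-one (+ r)) (cong -_ eq))

-- A solution divides `1`, so it is `1` or `- 1`; by parity `P` has the same absolute value at both,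
-- and that is at least two.
P-odd≢1 : ∀ q i c → ℤ.∣ P q (suc (i ℕ.+ i)) 1ℤ ∣ ≡ 2 ℕ.+ c → ∀ x → P q (suc (i ℕ.+ i)) x ≢ 1ℤ
P-odd≢1 q i c large x eq with P-odd≡1⇒unit q i x eq
... | inj₁ refl with () ← trans (sym large) (cong ℤ.∣_∣ eq)
... | inj₂ refl with () ← trans (sym large) (begin
  ℤ.∣ P q (suc (i ℕ.+ i)) 1ℤ ∣                                ≡⟨ sym (ℕ.*-identityˡ _) ⟩
  1 ℕ.* ℤ.∣ P q (suc (i ℕ.+ i)) 1ℤ ∣                          ≡⟨ cong (ℕ._* ℤ.∣ P q (suc (i ℕ.+ i)) 1ℤ ∣) (sym (∣sgn∣ (suc (i ℕ.+ i)))) ⟩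
  ℤ.∣ sgn (suc (i ℕ.+ i)) ∣ ℕ.* ℤ.∣ P q (suc (i ℕ.+ i)) 1ℤ ∣  ≡⟨ sym (ℤ.abs-* (sgn (suc (i ℕ.+ i))) (P q (suc (i ℕ.+ i)) 1ℤ)) ⟩
  ℤ.∣ sgn (suc (i ℕ.+ i)) * P q (suc (i ℕ.+ i)) 1ℤ ∣          ≡⟨ cong ℤ.∣_∣ (trans (sym (P-neg q (suc (i ℕ.+ i)) 1ℤ)) eq) ⟩
  1                                                            ∎)

P₃≢1 : ∀ r x → P (+ 5 + + r) 3 x ≢ 1ℤ
P₃≢1 r = P-odd≢1 (+ 5 + + r) 1 _ (proj₂ (∣P₃-one∣ r))

P₅≢1 : ∀ r x → P (+ 5 + + r) 5 x ≢ 1ℤ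
P₅≢1 r = P-odd≢1 (+ 5 + + r) 2 _ (proj₂ (∣P₅-one∣ r))

P₇≢1 : ∀ r x → P (+ 5 + + r) 7 x ≢ 1ℤ
P₇≢1 r = P-odd≢1 (+ 5 + + r) 3 _ (proj₂ (∣P₇-one∣ r))

-- For a matrix `S` of trace `t` and determinant `δ`, this rules out that `P q i` reduces to the
-- constant `1` modulo its characteristic polynomial.
NoIdentity : ℤ → ℕ → Set
NoIdentity q i = ∀ t δ → α q t δ i ≡ 0ℤ → β q t δ i ≢ 1ℤ

-- Here `α = t² - δ - 2 q` and `β = - t δ`, so `β = 1` forces `t = 1` or `t = - 1`. In these cases
-- `β - α - 1 = 2 q - 2` and `1 - α - β = 2 q` respectively; both would have to vanish, against
-- `q ≥ 5`.
noIdentity₃ : ∀ r → NoIdentity (+ 5 + + r) 3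
noIdentity₃ r t δ α≡0 β≡1 = [ case₊ , case₋ ]′ (unit t (- δ) (trans (lemma (+ 5 + + r) t δ) β≡1))
  where
  lemma : ∀ q t δ → t * - δ ≡ - δ * (t * 1ℤ + 0ℤ - q * 0ℤ) - q * 0ℤ
  lemma = solve-∀
  lemma₊ : ∀ r δ → + 8 + r * + 2 ≡
    - δ * (1ℤ * 1ℤ + 0ℤ - (+ 5 + r) * 0ℤ) - (+ 5 + r) * 0ℤ
    - (1ℤ * (1ℤ * 1ℤ + 0ℤ - (+ 5 + r) * 0ℤ) + (- δ * 1ℤ - (+ 5 + r) * 1ℤ) - (+ 5 + r) * 1ℤ) - 1ℤ
  lemma₊ = solve-∀
  lemma₋ : ∀ r δ → + 10 + r * + 2 ≡
    1ℤ - (- 1ℤ * (- 1ℤ * 1ℤ + 0ℤ - (+ 5 + r) * 0ℤ) + (- δ * 1ℤ - (+ 5 + r) * 1ℤ) - (+ 5 + r) * 1ℤ)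
    - (- δ * (- 1ℤ * 1ℤ + 0ℤ - (+ 5 + r) * 0ℤ) - (+ 5 + r) * 0ℤ)
  lemma₋ = solve-∀
  case₊ : ¬ t ≡ 1ℤ
  case₊ refl with m , eq ← horner-positive 8 r {+ 2} (ℤ.+≤+ z≤n)
    with () ← trans (sym eq) (trans (lemma₊ (+ r) δ) (cong₂ (λ a b → b - a - 1ℤ) α≡0 β≡1))
  case₋ : ¬ t ≡ - 1ℤ
  case₋ refl with m , eq ← horner-positive 10 r {+ 2} (ℤ.+≤+ z≤n)
    with () ← trans (sym eq) (trans (lemma₋ (+ r) δ) (cong₂ (λ a b → 1ℤ - a - b) α≡0 β≡1))

-- Reduction modulo 3

infix 4 _≈₃_

_≈₃_ : ℤ → ℤ → Set
x ≈₃ y = + 3 ∣ x - y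

≈₃-refl : ∀ {x} → x ≈₃ x
≈₃-refl {x} = divides 0ℤ (ℤ.+-inverseʳ x)

≈₃-+ : ∀ x x′ y y′ → x ≈₃ x′ → y ≈₃ y′ → x + y ≈₃ x′ + y′
≈₃-+ x x′ y y′ r s = subst (+ 3 ∣_) (lemma x x′ y y′) (∣m∣n⇒∣m+n r s)
  where
  lemma : ∀ x x′ y y′ → x - x′ + (y - y′) ≡ x + y - (x′ + y′)
  lemma = solve-∀

≈₃-neg : ∀ x x′ → x ≈₃ x′ → - x ≈₃ - x′
≈₃-neg x x′ r = subst (+ 3 ∣_) (lemma x x′) (∣m⇒∣-m r)
  where
  lemma : ∀ x x′ → - (x - x′) ≡ - x - - x′
  lemma = solve-∀

≈₃-* : ∀ x x′ y y′ → x ≈₃ x′ → y ≈₃ y′ → x * y ≈₃ x′ * y′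
≈₃-* x x′ y y′ r s = subst (+ 3 ∣_) (lemma x x′ y y′) (∣m∣n⇒∣m+n (∣m⇒∣m*n y r) (∣n⇒∣m*n x′ s))
  where
  lemma : ∀ x x′ y y′ → (x - x′) * y + x′ * (y - y′) ≡ x * y - x′ * y′
  lemma = solve-∀

module _ {q q′ t t′ δ δ′ : ℤ} (q≈ : q ≈₃ q′) (t≈ : t ≈₃ t′) (δ≈ : δ ≈₃ δ′) where

  α-≈₃ : ∀ i → α q t δ i ≈₃ α q′ t′ δ′ i
  β-≈₃ : ∀ i → β q t δ i ≈₃ β q′ t′ δ′ i
  α-≈₃ 0 = ≈₃-refl {0ℤ}
  α-≈₃ 1 = ≈₃-refl {1ℤ}
  α-≈₃ (suc (suc i)) =
    ≈₃-+ (t * α q t δ (suc i) + β q t δ (suc i)) (t′ * α q′ t′ δ′ (suc i) + β q′ t′ δ′ (suc i)) (- (q * α q t δ i)) (- (q′ * α q′ t′ δ′ i))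
      (≈₃-+ (t * α q t δ (suc i)) (t′ * α q′ t′ δ′ (suc i)) (β q t δ (suc i)) (β q′ t′ δ′ (suc i))
        (≈₃-* t t′ (α q t δ (suc i)) (α q′ t′ δ′ (suc i)) t≈ (α-≈₃ (suc i))) (β-≈₃ (suc i)))
      (≈₃-neg (q * α q t δ i) (q′ * α q′ t′ δ′ i) (≈₃-* q q′ (α q t δ i) (α q′ t′ δ′ i) q≈ (α-≈₃ i)))
  β-≈₃ 0 = ≈₃-refl {1ℤ}
  β-≈₃ 1 = ≈₃-refl {0ℤ}
  β-≈₃ (suc (suc i)) =
    ≈₃-+ (- δ * α q t δ (suc i)) (- δ′ * α q′ t′ δ′ (suc i)) (- (q * β q t δ i)) (- (q′ * β q′ t′ δ′ i))
      (≈₃-* (- δ) (- δ′) (α q t δ (suc i)) (α q′ t′ δ′ (suc i)) (≈₃-neg δ δ′ δ≈) (α-≈₃ (suc i)))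
      (≈₃-neg (q * β q t δ i) (q′ * β q′ t′ δ′ i) (≈₃-* q q′ (β q t δ i) (β q′ t′ δ′ i) q≈ (β-≈₃ i)))

residue : ∀ x → ∃ λ (ρ : Fin 3) → x ≈₃ + toℕ ρ
residue x = fromℕ< (n%ℕd<d x 3) , divides (x /ℕ 3) (begin
  x - + toℕ (fromℕ< (n%ℕd<d x 3))                ≡⟨ cong (λ y → x - + y) (toℕ-fromℕ< (n%ℕd<d x 3)) ⟩
  x - + (x %ℕ 3)                                 ≡⟨ cong (_- + (x %ℕ 3)) (a≡a%ℕn+[a/ℕn]*n x 3) ⟩
  + (x %ℕ 3) + (x /ℕ 3) * + 3 - + (x %ℕ 3)       ≡⟨ xyx⁻¹≈y (+ (x %ℕ 3)) ((x /ℕ 3) * + 3) ⟩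
  (x /ℕ 3) * + 3                                 ∎)

NoIdentityMod3 : ℕ → Set
NoIdentityMod3 i = ∀ (ρ σ : Fin 3) →
  ¬ (0ℤ ≈₃ α 0ℤ (+ toℕ ρ) (+ toℕ σ) i × 1ℤ ≈₃ β 0ℤ (+ toℕ ρ) (+ toℕ σ) i)

noIdentityMod3? : ∀ i → Dec (NoIdentityMod3 i)
noIdentityMod3? i = all? λ ρ → all? λ σ → ¬? ((+ 3 ∣? _) ×-dec (+ 3 ∣? _))

-- `α` and `β` are integer polynomials in `q`, `t`, `δ`, so a solution survives modulo 3. With `q`
-- congruent to `0`, only nine pairs of residues of `t` and `δ` remain to be tested.
noIdentity : ∀ {q} i → + 3 ∣ q → NoIdentityMod3 i → NoIdentity q i
noIdentity {q} i 3∣q none t δ α≡0 β≡1 with ρ , t≈ ← residue t | σ , δ≈ ← residue δ =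
  none ρ σ ( subst (_≈₃ α 0ℤ (+ toℕ ρ) (+ toℕ σ) i) α≡0 (α-≈₃ q≈0 t≈ δ≈ i)
           , subst (_≈₃ β 0ℤ (+ toℕ ρ) (+ toℕ σ) i) β≡1 (β-≈₃ q≈0 t≈ δ≈ i))
  where
  q≈0 : q ≈₃ 0ℤ
  q≈0 = subst (+ 3 ∣_) (sym (ℤ.+-identityʳ q)) 3∣q

-- For `q = 0` the polynomial is `x⁵`. The unit group of `F₃[x]/(x² - t x + δ)` has order 8, 4 or 6,
-- prime to 5 and to 7, so no such power of `x` is `1`. Index 3 would fail this test, since
-- `x³ - 1 = (x - 1)³` modulo 3.
noIdentity₅ : ∀ {q} → + 3 ∣ q → NoIdentity q 5
noIdentity₅ 3∣q = noIdentity 5 3∣q (from-yes (noIdentityMod3? 5))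

noIdentity₇ : ∀ {q} → + 3 ∣ q → NoIdentity q 7
noIdentity₇ 3∣q = noIdentity 7 3∣q (from-yes (noIdentityMod3? 7))

-- The action of A on the eigenspace

module _ {n : ℕ} (G : Graph n) (q e : ℕ) (5≤q : 5 ≤ q) (odd : Even (suc e))
  (regular : Regular (suc q) G) (girth≥ : ∀ m → Cycle G m → 2 ℕ.* suc e ≤ m)
  (order : n ≡ 2 ℕ.* geo q e ℕ.+ 4)
  (single : IsSingleCycle (excessGraph G (suc e)))
  (t : ℕ) (n≡3t : n ≡ t ℕ.* 3) where

  private
    3≤n : 3 ≤ n
    3≤n = proj₁ single

    1<n : 1 < n
    1<n = ℕ.<⇒≤ 3≤n

    pos at : Fin n → Fin n
    pos = Bijection.to (proj₁ (proj₂ single))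
    at  = Inverse.from (⤖⇒↔ (proj₁ (proj₂ single)))

    pos-at : ∀ i → pos (at i) ≡ i
    pos-at = Inverse.strictlyInverseˡ (⤖⇒↔ (proj₁ (proj₂ single)))

    at-pos : ∀ u → at (pos u) ≡ u
    at-pos = Inverse.strictlyInverseʳ (⤖⇒↔ (proj₁ (proj₂ single)))

    next prev : Fin n → Fin n
    next u = at (proj₁ (cyclicSuccessor (pos u)))
    prev u = at (proj₁ (cyclicPredecessor (pos u)))

    succ-next : ∀ u → CyclicSucc (pos u) (pos (next u))
    succ-next u = subst (CyclicSucc (pos u)) (sym (pos-at _)) (proj₂ (cyclicSuccessor (pos u)))

    succ-prev : ∀ u → CyclicSucc (pos (prev u)) (pos u)
    succ-prev u = subst (λ i → CyclicSucc i (pos u)) (sym (pos-at _)) (proj₂ (cyclicPredecessor (pos u)))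

    pos-injective : ∀ {u v} → pos u ≡ pos v → u ≡ v
    pos-injective = Bijection.injective (proj₁ (proj₂ single))

    next≢prev : ∀ u → next u ≢ prev u
    next≢prev u eq = cyclicSucc-asym 3≤n (succ-next u)
      (subst (λ v → CyclicSucc (pos v) (pos u)) (sym eq) (succ-prev u))

    far-only : ∀ u v → Distance G u v (2 ℕ.+ e) → v ≡ next u ⊎ v ≡ prev u
    far-only u v d with Equivalence.to (proj₂ (proj₂ single) u v) d
    ... | inj₁ s = inj₁ (pos-injective (cyclicSucc-functional s (succ-next u)))
    ... | inj₂ s = inj₂ (pos-injective (cyclicSucc-injective s (succ-prev u)))

  open CyclicExcess G q e 5≤q odd regular girth≥ order next prev next≢prev
    (λ u → Equivalence.from (proj₂ (proj₂ single) u (next u)) (inj₁ (succ-next u)))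
    (λ u → Equivalence.from (proj₂ (proj₂ single) u (prev u)) (inj₂ (succ-prev u)))
    far-only

  private
    A : Fin n → Fin n → ℤ
    A = adjacency G

    -- Evaluation at these two vertices reads off the coordinates of an eigenfunction in the basis
    -- `f₀`, `f₁`.
    o₀ o₁ : Fin n
    o₀ = at (fromℕ< (ℕ.<⇒≤ 1<n))
    o₁ = at (fromℕ< 1<n)

    φ : ℤ → ℤ → Fin n → ℤ
    φ x y u = wave x y (toℕ (pos u))

    φ-eigen : ∀ x y → EigenE (φ x y)
    φ-eigen x y u = trans (E▹ (φ x y) u) (wave-triple x y t n≡3t (succ-prev u) (succ-next u))

    φ-o₀ : ∀ x y → φ x y o₀ ≡ x
    φ-o₀ x y = cong (wave x y) (trans (cong toℕ (pos-at _)) (toℕ-fromℕ< (ℕ.<⇒≤ 1<n)))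

    φ-o₁ : ∀ x y → φ x y o₁ ≡ y
    φ-o₁ x y = cong (wave x y) (trans (cong toℕ (pos-at _)) (toℕ-fromℕ< 1<n))

    -- Read along the cycle, the eigenvalue equation is the recurrence of `wave`.
    eigen-φ : ∀ f → EigenE f → ∀ u → f u ≡ f o₀ * φ 1ℤ 0ℤ u + f o₁ * φ 0ℤ 1ℤ u
    eigen-φ f eigen u = begin
      f u                                      ≡⟨ cong f (sym (at-pos u)) ⟩
      f (at (pos u))                           ≡⟨ wave-unique 1<n (λ i → f (at i)) triple (pos u) ⟩
      φ (f o₀) (f o₁) u                        ≡⟨ wave-linear (f o₀) (f o₁) (toℕ (pos u)) ⟩
      f o₀ * φ 1ℤ 0ℤ u + f o₁ * φ 0ℤ 1ℤ u      ∎
      where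
      triple : ∀ {i j k} → CyclicSucc i j → CyclicSucc j k → f (at k) + f (at i) ≡ - f (at j)
      triple {i} {j} {k} r s = trans
        (cong₂ (λ x y → f (at x) + f (at y))
          (cyclicSucc-functional s (proj₂ (cyclicSuccessor j)))
          (cyclicSucc-injective r (proj₂ (cyclicPredecessor j))))
        (trans (cong₂ (λ x y → f (at (proj₁ (cyclicSuccessor x))) + f (at (proj₁ (cyclicPredecessor y))))
                  (sym (pos-at j)) (sym (pos-at j)))
          (trans (sym (E▹ f (at j))) (eigen (at j))))

    f₀ f₁ : Fin n → ℤ
    f₀ = φ 1ℤ 0ℤ
    f₁ = φ 0ℤ 1ℤ

    -- The entries of the integer matrix `S` of `A` in the basis `f₀`, `f₁`; `a + d` is its trace
    -- and `a * d - b * c` its determinant.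
    a b c d : ℤ
    a = (A ▹ f₀) o₀
    b = (A ▹ f₀) o₁
    c = (A ▹ f₁) o₀
    d = (A ▹ f₁) o₁

    A▹f₀ : ∀ u → (A ▹ f₀) u ≡ a * f₀ u + b * f₁ u
    A▹f₀ = eigen-φ (A ▹ f₀) (A▹eigen f₀ (φ-eigen 1ℤ 0ℤ))

    A▹f₁ : ∀ u → (A ▹ f₁) u ≡ c * f₀ u + d * f₁ u
    A▹f₁ = eigen-φ (A ▹ f₁) (A▹eigen f₁ (φ-eigen 0ℤ 1ℤ))

    cayley-hamilton : ∀ u → (A ▹ A ▹ f₀) u ≡ (a + d) * (A ▹ f₀) u - (a * d - b * c) * f₀ u
    cayley-hamilton u = begin
      (A ▹ A ▹ f₀) u                                 ≡⟨ ▹-cong A A▹f₀ u ⟩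
      (A ▹ (λ v → a * f₀ v + b * f₁ v)) u            ≡⟨ ▹-linear A a b f₀ f₁ u ⟩
      a * (A ▹ f₀) u + b * (A ▹ f₁) u                ≡⟨ cong₂ (λ x y → a * x + b * y) (A▹f₀ u) (A▹f₁ u) ⟩
      a * (a * f₀ u + b * f₁ u) + b * (c * f₀ u + d * f₁ u)
        ≡⟨ lemma a b c d (f₀ u) (f₁ u) ⟩
      (a + d) * (a * f₀ u + b * f₁ u) - (a * d - b * c) * f₀ u
        ≡⟨ cong (λ x → (a + d) * x - (a * d - b * c) * f₀ u) (sym (A▹f₀ u)) ⟩
      (a + d) * (A ▹ f₀) u - (a * d - b * c) * f₀ u  ∎
      where
      lemma : ∀ a b c d x y →
        a * (a * x + b * y) + b * (c * x + d * y) ≡ (a + d) * (a * x + b * y) - (a * d - b * c) * x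
      lemma = solve-∀

    αᵢ βᵢ : ℕ → ℤ
    αᵢ = α (+ q) (a + d) (a * d - b * c)
    βᵢ = β (+ q) (a + d) (a * d - b * c)

    -- Replacing the square of `A` by `cayley-hamilton` turns the recursion of `NB` into that of `α`
    -- and `β`.
    NB-αβ : ∀ i u → NB G q i f₀ u ≡ αᵢ i * (A ▹ f₀) u + βᵢ i * f₀ u
    NB-αβ 0 u = lemma (f₀ u) ((A ▹ f₀) u)
      where
      lemma : ∀ x y → x ≡ 0ℤ * y + 1ℤ * x
      lemma = solve-∀
    NB-αβ 1 u = lemma (f₀ u) ((A ▹ f₀) u)
      where
      lemma : ∀ x y → y ≡ 1ℤ * y + 0ℤ * x
      lemma = solve-∀
    NB-αβ (suc (suc i)) u = trans
      (cong₂ (λ x y → 1ℤ * x + - (+ q) * y)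
        (trans (▹-cong A (NB-αβ (suc i)) u)
          (trans (▹-linear A (αᵢ (suc i)) (βᵢ (suc i)) (A ▹ f₀) f₀ u)
            (cong (λ x → αᵢ (suc i) * x + βᵢ (suc i) * (A ▹ f₀) u) (cayley-hamilton u))))
        (NB-αβ i u))
      (lemma (+ q) (a + d) (a * d - b * c) (αᵢ (suc i)) (βᵢ (suc i)) (αᵢ i) (βᵢ i) ((A ▹ f₀) u) (f₀ u))
      where
      lemma : ∀ q t δ x y x′ y′ g f →
        1ℤ * (x * (t * g - δ * f) + y * g) + - q * (x′ * g + y′ * f)
          ≡ (t * x + y - q * x′) * g + (- δ * x - q * y′) * f
      lemma = solve-∀

    αβ-f₀ : ∀ u → αᵢ e * (A ▹ f₀) u + βᵢ e * f₀ u ≡ f₀ u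
    αβ-f₀ u = trans (sym (NB-αβ e u)) (NB-eigen f₀ (φ-eigen 1ℤ 0ℤ) u)

    -- This is `αβ-f₀` at `o₀`, where `A ▹ f₀` is `a` and `f₀` is `1`. At `o₁` these values are `b`
    -- and `0`, which gives the companion equation `αb≡0`.
    αa+β≡1 : αᵢ e * a + βᵢ e ≡ 1ℤ
    αa+β≡1 = begin
      αᵢ e * a + βᵢ e           ≡⟨ cong (λ x → αᵢ e * a + x) (sym (ℤ.*-identityʳ (βᵢ e))) ⟩
      αᵢ e * a + βᵢ e * 1ℤ      ≡⟨ cong (λ x → αᵢ e * a + βᵢ e * x) (sym (φ-o₀ 1ℤ 0ℤ)) ⟩
      αᵢ e * a + βᵢ e * f₀ o₀   ≡⟨ αβ-f₀ o₀ ⟩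
      f₀ o₀                     ≡⟨ φ-o₀ 1ℤ 0ℤ ⟩
      1ℤ                        ∎

    αb≡0 : αᵢ e * b ≡ 0ℤ
    αb≡0 = begin
      αᵢ e * b                  ≡⟨ lemma (αᵢ e * b) (βᵢ e) ⟩
      αᵢ e * b + βᵢ e * 0ℤ      ≡⟨ cong (λ x → αᵢ e * b + βᵢ e * x) (sym (φ-o₁ 1ℤ 0ℤ)) ⟩
      αᵢ e * b + βᵢ e * f₀ o₁   ≡⟨ αβ-f₀ o₁ ⟩
      f₀ o₁                     ≡⟨ φ-o₁ 1ℤ 0ℤ ⟩
      0ℤ                        ∎
      where
      lemma : ∀ x y → x ≡ x + y * 0ℤ
      lemma = solve-∀

  -- The product `α b` vanishes. If `α = 0`, then `P_e` reduces to the constant `1`. If `b = 0`,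
  -- then `f₀` is an eigenvector of `A` with integer eigenvalue `a`, and `P_e(a) = 1`.
  noCyclicExcess : (∀ x → P (+ q) e x ≢ 1ℤ) → ¬ NoIdentity (+ q) e
  noCyclicExcess noRoot noId = [ α≡0 , b≡0 ]′ (ℤ.i*j≡0⇒i≡0∨j≡0 (αᵢ e) αb≡0)
    where
    α≡0 : αᵢ e ≢ 0ℤ
    α≡0 eq = noId (a + d) (a * d - b * c) eq (begin
      βᵢ e              ≡⟨ sym (ℤ.+-identityˡ (βᵢ e)) ⟩
      0ℤ * a + βᵢ e     ≡⟨ cong (λ x → x * a + βᵢ e) (sym eq) ⟩
      αᵢ e * a + βᵢ e   ≡⟨ αa+β≡1 ⟩
      1ℤ                ∎)
    b≡0 : b ≢ 0ℤ
    b≡0 eq = noRoot a (begin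
      P (+ q) e a       ≡⟨ sym (P-root (+ q) a d e) ⟩
      α (+ q) (a + d) (a * d) e * a + β (+ q) (a + d) (a * d) e
        ≡⟨ cong (λ δ → α (+ q) (a + d) δ e * a + β (+ q) (a + d) δ e) (sym det) ⟩
      αᵢ e * a + βᵢ e   ≡⟨ αa+β≡1 ⟩
      1ℤ                ∎)
      where
      lemma : ∀ a d c → a * d - 0ℤ * c ≡ a * d
      lemma = solve-∀
      det : a * d - b * c ≡ a * d
      det = trans (cong (λ b → a * d - b * c) eq) (lemma a d c)

-- The order modulo 3 and the three girths

girth-half : ∀ {g d} e → g ≡ 2 ℕ.* d → g ≡ 2 ℕ.* suc e → d ≡ suc e
girth-half {d = d} e r s = ℕ.*-cancelˡ-≡ d (suc e) 2 (trans (sym r) s)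

∸≡4⇒≡+4 : ∀ n m → n ℕ.∸ m ≡ 4 → n ≡ m ℕ.+ 4
∸≡4⇒≡+4 n m eq = trans (sym (ℕ.m+[n∸m]≡n m≤n)) (cong (m ℕ.+_) eq)
  where
  m≤n : m ≤ n
  m≤n with ℕ.≤-total m n
  ... | inj₁ m≤n = m≤n
  ... | inj₂ n≤m with () ← trans (sym (ℕ.m≤n⇒m∸n≡0 n≤m)) eq

impossible : ∀ {g n} (G : Graph n) r e → Even (suc e) → g ≡ 2 ℕ.* suc e →
  (∀ x → P (+ 5 + + r) e x ≢ 1ℤ) → NoIdentity (+ 5 + + r) e →
  (∃ λ t → 2 ℕ.* geo (5 ℕ.+ r) e ℕ.+ 4 ≡ t ℕ.* 3) → ¬ HasCyclicExcess4 (6 ℕ.+ r) g G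
impossible {n = n} G r e odd g≡ noRoot noId (t , 3∣order) record
  { isKGGraph = regular , _ , girth≥ ; d = d ; evenGirth = g≡2d ; excess = excess ; isSingleCycle = single }
  with refl ← girth-half {d = d} e g≡2d g≡ | refl ← g≡ =
  noCyclicExcess G (5 ℕ.+ r) e (ℕ.m≤m+n 5 r) odd regular girth≥ order single t (trans order 3∣order) noRoot noId
  where
  order : n ≡ 2 ℕ.* geo (5 ℕ.+ r) e ℕ.+ 4
  order = trans (∸≡4⇒≡+4 n (mooreBound (6 ℕ.+ r) (suc e)) excess) (cong (ℕ._+ 4) (mooreBound-geo (5 ℕ.+ r) e))

-- Modulo 3 the geometric sum is `1`, so the order is `2 + 4`.
order-div₀ : ∀ q s e → q ≡ s ℕ.* 3 → ∃ λ t → 2 ℕ.* geo q (suc e) ℕ.+ 4 ≡ t ℕ.* 3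
order-div₀ q s e refl = 2 ℕ.+ 2 ℕ.* s ℕ.* geo q e , lemma s (geo (s ℕ.* 3) e)
  where
  lemma : ∀ s x → 2 ℕ.* (1 ℕ.+ s ℕ.* 3 ℕ.* x) ℕ.+ 4 ≡ (2 ℕ.+ 2 ℕ.* s ℕ.* x) ℕ.* 3
  lemma = ℕsolve-∀

-- Modulo 3 the four powers of `q` sum to `4`, so the order is `2 * 4 + 4 = 12`; the witness is the
-- exact quotient, expanded in `s`.
order-div₁ : ∀ q s → q ≡ 1 ℕ.+ s ℕ.* 3 → ∃ λ t → 2 ℕ.* geo q 3 ℕ.+ 4 ≡ t ℕ.* 3
order-div₁ q s refl = 4 ℕ.+ 12 ℕ.* s ℕ.+ 24 ℕ.* s ℕ.* s ℕ.+ 18 ℕ.* s ℕ.* s ℕ.* s , lemma s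
  where
  lemma : ∀ s → 2 ℕ.* (1 ℕ.+ (1 ℕ.+ s ℕ.* 3) ℕ.* (1 ℕ.+ (1 ℕ.+ s ℕ.* 3) ℕ.* (1 ℕ.+ (1 ℕ.+ s ℕ.* 3) ℕ.* 1))) ℕ.+ 4
    ≡ (4 ℕ.+ 12 ℕ.* s ℕ.+ 24 ℕ.* s ℕ.* s ℕ.+ 18 ℕ.* s ℕ.* s ℕ.* s) ℕ.* 3
  lemma = ℕsolve-∀

k%3≡1+m⇒ : ∀ q m → suc q % 3 ≡ suc m → q ≡ m ℕ.+ suc q / 3 ℕ.* 3
k%3≡1+m⇒ q m eq = ℕ.suc-injective (trans (m≡m%n+[m/n]*n (suc q) 3) (cong (ℕ._+ suc q / 3 ℕ.* 3) eq))

theorem3p3 : ∀ (k g : ℕ) → 6 ≤ k →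
    (((k % 3 ≡ 1 ⊎ k % 3 ≡ 2) × g ≡ 8) ⊎ (k % 3 ≡ 1 × g ≡ 12) ⊎ (k % 3 ≡ 1 × g ≡ 16)) →
    ¬ (∃[ n ] Σ (Graph n) (λ G → HasCyclicExcess4 k g G))
theorem3p3 k g 6≤k cond (n , G , excess4) with r , refl ← ℕ.m≤n⇒∃[o]m+o≡n 6≤k = go cond
  where
  q : ℕ
  q = 5 ℕ.+ r
  s : ℕ
  s = (6 ℕ.+ r) / 3
  3∣q : suc q % 3 ≡ 1 → + 3 ∣ + q
  3∣q eq = divides (+ s) (trans (cong +_ (k%3≡1+m⇒ q 0 eq)) (ℤ.pos-* s 3))
  go : ¬ (((suc q % 3 ≡ 1 ⊎ suc q % 3 ≡ 2) × g ≡ 8) ⊎ (suc q % 3 ≡ 1 × g ≡ 12) ⊎ (suc q % 3 ≡ 1 × g ≡ 16))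
  -- The values `3`, `5`, `7` of `e` are `g / 2 - 1` for girths 8, 12, 16, and `k` congruent to `1`
  -- or `2` means `q` congruent to `0` or `1`.
  go (inj₁ (inj₁ eq , g≡8)) = impossible G r 3 (2+ (2+ zero)) g≡8 (P₃≢1 r) (noIdentity₃ r)
    (order-div₀ q s 2 (k%3≡1+m⇒ q 0 eq)) excess4
  go (inj₁ (inj₂ eq , g≡8)) = impossible G r 3 (2+ (2+ zero)) g≡8 (P₃≢1 r) (noIdentity₃ r)
    (order-div₁ q s (k%3≡1+m⇒ q 1 eq)) excess4
  go (inj₂ (inj₁ (eq , g≡12))) = impossible G r 5 (2+ (2+ (2+ zero))) g≡12 (P₅≢1 r) (noIdentity₅ (3∣q eq))
    (order-div₀ q s 4 (k%3≡1+m⇒ q 0 eq)) excess4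
  go (inj₂ (inj₂ (eq , g≡16))) = impossible G r 7 (2+ (2+ (2+ (2+ zero)))) g≡16 (P₇≢1 r) (noIdentity₇ (3∣q eq))
    (order-div₀ q s 6 (k%3≡1+m⇒ q 0 eq)) excess4
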